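{- Let $G$ be a finite simple undirected graph with vertex set $V$, $|V|=n$, edge set $E$, $|E|=m\ge 1$, clique number $\omega$ and vertex degrees $d_i$ ($i\in V$), and let $\mu$ be the largest eigenvalue of its adjacency matrix. Put $$\beta=\frac{\mu n}{2m},\qquad \nu=\frac{n\sum_{i\in V}d_i^2}{4m^2},\qquad \epsilon=\frac{n\sum_{ij\in E}\sqrt{d_id_j}}{2m^2}.$$ Then $$2m\le\frac{(\omega-1)n^2}{\omega\beta^2},$$ and moreover $$\text{(i)}\quad 2m\le\frac{(\omega-1)n^2}{\omega\nu}\qquad\text{and}\qquad\text{(ii)}\quad 2m\le\frac{(\omega-1)n^2}{\omega\epsilon^2}.$$
   Context: The clique number $\omega$ is the number of vertices of a largest complete subgraph of $G$. The sum over $ij\in E$ runs over each (unordered) edge once. The quantities $\beta,\nu,\epsilon$ are measures of irregularity of $G$, defined for graphs with at least one edge. -}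

module Defs where

open import Algebra.Bundles using (CommutativeRing)
open import Algebra.Structures using (IsCommutativeRing)
open import Data.Bool.Base using (if_then_else_)
open import Data.Fin.Base using (Fin; _<_)
open import Data.Fin.Properties using (_<?_)
open import Data.Fin.Subset using (Subset; _∈_; ∣_∣)
import Data.List.Base as List
open List using (List)
open import Data.Nat.Base as ℕ using (ℕ)
open import Data.Product using (∃; _×_; _,_; proj₁; uncurry)
open import Data.Sum.Base using (_⊎_; inj₁; inj₂)
open import Level using (Level; _⊔_; suc; 0ℓ)
open import Relation.Binary.Core using (Rel)
open import Relation.Binary.Definitions using (Decidable; Irreflexive; Symmetric)
open import Relation.Binary.PropositionalEquality using (_≡_; _≢_)
open import Relation.Binary.Structures using (IsDecTotalOrder)
open import Relation.Nullary using (¬_; yes; no; does)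
open import Relation.Nullary.Decidable using (_×-dec_)
open import Relation.Unary using (Pred)

-- The real numbers are given by their classical axioms, those of a
-- Dedekind-complete ordered field, which determine them up to isomorphism.
-- The order is decidable, as it is for the classical reals.
record CompleteOrderedField (c ℓ₁ ℓ₂ : Level) : Set (suc (c ⊔ ℓ₁ ⊔ ℓ₂)) where
  infixl 7 _*_
  infixl 6 _+_
  infix  8 -_
  infix  4 _≈_ _≤_
  field
    Carrier           : Set c
    _≈_               : Rel Carrier ℓ₁
    _≤_               : Rel Carrier ℓ₂
    _+_ _*_           : Carrier → Carrier → Carrier
    -_                : Carrier → Carrier
    0# 1#             : Carrier
    isCommutativeRing : IsCommutativeRing _≈_ _+_ _*_ -_ 0# 1#
    isDecTotalOrder   : IsDecTotalOrder _≈_ _≤_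
    0≉1               : ¬ (0# ≈ 1#)
    inverse           : ∀ x → ¬ (x ≈ 0#) → ∃ λ y → x * y ≈ 1#
    +-monoˡ-≤         : ∀ {x y} z → x ≤ y → x + z ≤ y + z
    *-nonNeg          : ∀ {x y} → 0# ≤ x → 0# ≤ y → 0# ≤ x * y

  IsUpperBound : Pred Carrier (c ⊔ ℓ₁ ⊔ ℓ₂) → Carrier → Set (c ⊔ ℓ₁ ⊔ ℓ₂)
  IsUpperBound P b = ∀ x → P x → x ≤ b

  IsLeastUpperBound : Pred Carrier (c ⊔ ℓ₁ ⊔ ℓ₂) → Carrier → Set (c ⊔ ℓ₁ ⊔ ℓ₂)
  IsLeastUpperBound P s = IsUpperBound P s × (∀ b → IsUpperBound P b → s ≤ b)

  field
    complete : ∀ P → ∃ P → ∃ (IsUpperBound P) → ∃ (IsLeastUpperBound P)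

  open IsDecTotalOrder isDecTotalOrder public
    using (_≟_; _≤?_; total; ≤-respˡ-≈; ≤-respʳ-≈)
    renaming (refl to ≤-refl; reflexive to ≤-reflexive; trans to ≤-trans;
              antisym to ≤-antisym)

  commutativeRing : CommutativeRing c ℓ₁
  commutativeRing = record { isCommutativeRing = isCommutativeRing }

  open CommutativeRing commutativeRing public
    hiding (Carrier; _≈_; _+_; _*_; -_; 0#; 1#; isCommutativeRing)

module RealOps {c ℓ₁ ℓ₂} (ℝ : CompleteOrderedField c ℓ₁ ℓ₂) where
  open CompleteOrderedField ℝ
  open import Algebra.Properties.Ring ring
    using (-‿distribˡ-*; -‿distribʳ-*; -‿involutive)
  open import Algebra.Properties.Semiring.Exp semiring public using (_^_)
  open import Algebra.Properties.Monoid.Sum +-monoid public using (sum)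
  open import Algebra.Properties.Monoid.Mult +-monoid
    using () renaming (_×_ to _·_)

  infixl 7 _/_
  infix  9 _⁻¹

  fromℕ : ℕ → Carrier
  fromℕ n = n · 1#

  -- Total inverse, with 0⁻¹ = 0.
  _⁻¹ : Carrier → Carrier
  x ⁻¹ with x ≟ 0#
  ... | yes _  = 0#
  ... | no x≉0 = proj₁ (inverse x x≉0)

  _/_ : Carrier → Carrier → Carrier
  x / y = x * y ⁻¹

  private
    neg-nonNeg : ∀ {x} → x ≤ 0# → 0# ≤ - x
    neg-nonNeg {x} x≤0 =
      ≤-respˡ-≈ (-‿inverseʳ x) (≤-respʳ-≈ (+-identityˡ (- x)) (+-monoˡ-≤ (- x) x≤0))

    0≤1 : 0# ≤ 1#
    0≤1 with total 0# 1#
    ... | inj₁ 0≤1 = 0≤1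
    ... | inj₂ 1≤0 = ≤-respʳ-≈ -1*-1≈1 (*-nonNeg (neg-nonNeg 1≤0) (neg-nonNeg 1≤0))
      where
      -1*-1≈1 : - 1# * - 1# ≈ 1#
      -1*-1≈1 = trans (sym (-‿distribˡ-* 1# (- 1#)))
                (trans (-‿cong (*-identityˡ (- 1#))) (-‿involutive 1#))

    x≤x*x : ∀ {x} → 1# ≤ x → x ≤ x * x
    x≤x*x {x} 1≤x =
      ≤-respˡ-≈ (+-identityˡ x)
        (≤-respʳ-≈ [x-1]x+x≈x*x
          (+-monoˡ-≤ x (*-nonNeg 0≤x-1 (≤-trans 0≤1 1≤x))))
      where
      0≤x-1 : 0# ≤ x + - 1#
      0≤x-1 = ≤-respˡ-≈ (-‿inverseʳ 1#) (+-monoˡ-≤ (- 1#) 1≤x)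
      [x-1]x+x≈x*x : (x + - 1#) * x + x ≈ x * x
      [x-1]x+x≈x*x =
        trans (+-congˡ (sym (*-identityˡ x)))
        (trans (sym (distribʳ x (x + - 1#) 1#))
        (*-congʳ (trans (+-assoc x (- 1#) 1#)
          (trans (+-congˡ (-‿inverseˡ 1#)) (+-identityʳ x)))))

    upper : ∀ x → ∃ λ b → 1# ≤ b × x ≤ b
    upper x with total 1# x
    ... | inj₁ 1≤x = x , 1≤x , ≤-refl
    ... | inj₂ x≤1 = 1# , ≤-refl , x≤1

  -- The supremum of this set is the square root of x when 0 ≤ x; the
  -- condition y ≤ 0 only keeps the set inhabited for negative x.
  RootBelow : Carrier → Pred Carrier (c ⊔ ℓ₁ ⊔ ℓ₂)
  RootBelow x y = Level.Lift (c ⊔ ℓ₁ ⊔ ℓ₂) (y ≤ 0# ⊎ y * y ≤ x)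

  rootBelow-inhabited : ∀ x → ∃ (RootBelow x)
  rootBelow-inhabited x = 0# , Level.lift (inj₁ ≤-refl)

  rootBelow-bounded : ∀ x → ∃ (IsUpperBound (RootBelow x))
  rootBelow-bounded x with upper x
  ... | b , 1≤b , x≤b = b , bound
    where
    bound : IsUpperBound (RootBelow x) b
    bound y (Level.lift (inj₁ y≤0)) = ≤-trans y≤0 (≤-trans 0≤1 1≤b)
    bound y (Level.lift (inj₂ y²≤x)) with total y b
    ... | inj₁ y≤b = y≤b
    ... | inj₂ b≤y = ≤-trans (x≤x*x (≤-trans 1≤b b≤y)) (≤-trans y²≤x x≤b)

  √_ : Carrier → Carrier
  √ x = proj₁ (complete (RootBelow x) (rootBelow-inhabited x) (rootBelow-bounded x))

  Matrix : ℕ → Set c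
  Matrix n = Fin n → Fin n → Carrier

  IsEigenvalue : ∀ {n} → Matrix n → Carrier → Set (c ⊔ ℓ₁)
  IsEigenvalue {n} A μ =
    ∃ λ (x : Fin n → Carrier) →
      (∃ λ i → ¬ (x i ≈ 0#)) × (∀ i → sum (λ j → A i j * x j) ≈ μ * x i)

  IsLargestEigenvalue : ∀ {n} → Matrix n → Carrier → Set (c ⊔ ℓ₁ ⊔ ℓ₂)
  IsLargestEigenvalue A μ =
    IsEigenvalue A μ × (∀ μ′ → IsEigenvalue A μ′ → μ′ ≤ μ)

record SimpleGraph (n : ℕ) : Set₁ where
  infix 4 _~_ _~?_
  field
    _~_    : Rel (Fin n) 0ℓ
    _~?_   : Decidable _~_
    symm   : Symmetric _~_
    irrefl : Irreflexive _≡_ _~_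

  degree : Fin n → ℕ
  degree i = List.length (List.filter (i ~?_) (List.allFin n))

  -- Each unordered edge ij is listed once, as the pair (i , j) with i < j.
  edges : List (Fin n × Fin n)
  edges = List.filter (λ (i , j) → (i <? j) ×-dec (i ~? j))
                      (List.cartesianProduct (List.allFin n) (List.allFin n))

  edgeCount : ℕ
  edgeCount = List.length edges

  IsClique : Subset n → Set
  IsClique S = ∀ {i j} → i ∈ S → j ∈ S → i ≢ j → i ~ j

  IsCliqueNumber : ℕ → Set
  IsCliqueNumber ω =
    (∃ λ S → IsClique S × ∣ S ∣ ≡ ω) × (∀ S → IsClique S → ∣ S ∣ ℕ.≤ ω)

module Irregularity {c ℓ₁ ℓ₂} (ℝ : CompleteOrderedField c ℓ₁ ℓ₂)
                    {n : ℕ} (G : SimpleGraph n) where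
  open CompleteOrderedField ℝ
  open RealOps ℝ
  open SimpleGraph G

  adjacencyMatrix : Matrix n
  adjacencyMatrix i j = if does (i ~? j) then 1# else 0#

  private
    m : Carrier
    m = fromℕ edgeCount

    d : Fin n → Carrier
    d i = fromℕ (degree i)

  sumOverEdges : (Fin n → Fin n → Carrier) → Carrier
  sumOverEdges f = List.foldr _+_ 0# (List.map (uncurry f) edges)

  β : Carrier → Carrier
  β μ = (μ * fromℕ n) / (fromℕ 2 * m)

  ν : Carrier
  ν = (fromℕ n * sum (λ i → d i ^ 2)) / (fromℕ 4 * m ^ 2)

  ϵ : Carrier
  ϵ = (fromℕ n * sumOverEdges (λ i j → √ (d i * d j))) / (fromℕ 2 * m ^ 2)

{-# OPTIONS --safe #-}

-- Writing q(x) = xᵀAx, Motzkin and Straus give ω q(y) ≤ (ω − 1)(Σ y)² for y ≥ 0: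
-- along e_i − e_j with i, j non-adjacent q is affine, so mass can be moved
-- until the support of y is a clique.  By Cauchy–Schwarz over the edges,
-- q(x)² ≤ 2m q(x²) with x² taken entrywise, whence Nikiforov's
-- ω q(x)² ≤ 2m (ω − 1) |x|⁴.  An eigenvector x for μ gives the bound with β;
-- since A is symmetric, |Ax|² ≤ 2m (ω − 1)/ω |x|² follows, and x = (1, …, 1)
-- gives (i).  For (ii), (Σ √(d_i d_j))² ≤ m Σ d_i d_j, and Motzkin–Straus
-- applies to y = d.  That β ≠ 0 needs an eigenvalue at least as large as the
-- average degree 2m/n.

module Submission where

open import Defs
open import Algebra.Bundles using (CommutativeRing)
import Algebra.Solver.Ring
open import Algebra.Solver.Ring.AlmostCommutativeRing
  using (fromCommutativeRing; _-Raw-AlmostCommutative⟶_)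
open import Data.Bool.Base using (true; false; _∧_; if_then_else_)
open import Data.Fin.Base as Fin using (Fin; zero; suc)
open import Data.Fin.Properties as Fin using (any?; _<?_; <-cmp)
open import Data.Fin.Subset using (Subset; inside; outside; _∈_; _∉_; ∣_∣; ⊤; ⁅_⁆)
  renaming (_-_ to _∖_)
open import Data.Fin.Subset.Properties
  using (_∈?_; ∈⊤; ∣⊤∣≡n; x∈p⇒∣p-x∣<∣p∣; x∈p∧x≢y⇒x∈p-y; ∣⁅x⁆∣≡1; x∈⁅y⁆⇒x≡y)
open import Data.Integer.Base as ℤ using (ℤ; +_; -[1+_])
import Data.Integer.Properties as ℤ
open import Data.List.Base as List using (List; []; _∷_; _++_)
open import Data.List.Relation.Unary.All as All using (All; []; _∷_)
open import Data.List.Relation.Unary.All.Properties using (all-filter)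
import Data.Maybe.Base as Maybe
open import Data.Nat.Base as ℕ using (ℕ; zero; suc)
import Data.Nat.Properties as ℕ
open import Data.Product using (∃; _×_; _,_; proj₁; proj₂; uncurry)
open import Data.Sum.Base as Sum using (_⊎_; inj₁; inj₂)
open import Data.Vec.Base using ([]; _∷_; here; there)
open import Data.Vec.Functional as Vector using (tail)
open import Function.Base using (_∘_; id)
open import Level using (Level; _⊔_; Lift; lift)
open import Relation.Binary.Bundles using (Poset)
open import Relation.Binary.Definitions using (tri<; tri≈; tri>)
open import Relation.Binary.PropositionalEquality as ≡ using (_≡_; _≢_)
import Relation.Binary.Reasoning.PartialOrder
open import Relation.Binary.Structures using (IsDecTotalOrder)
open import Relation.Nullary using (¬_; Dec; yes; no; does; contradiction)
open import Relation.Nullary.Decidable using (¬?; _×-dec_; dec-true; dec-false)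
open import Relation.Nullary.Decidable.Core using (dec⇒maybe)
open import Relation.Unary using (Pred; Decidable)

-- Division is total and sends 0 to the inverse 0, so a vanishing β, ν or ϵ would turn its bound
-- into 2m ≤ 0; each has to be shown nonzero. For β the obstacle is that μ is known only as an
-- eigenvalue that no other exceeds, so comparing it with 2m/n requires producing a second
-- eigenvalue. Completeness is given as existence of suprema, with neither diagonalisation nor
-- compactness of the sphere at hand. Elimination replaces both: a symmetric positive semidefinite
-- matrix either has a null vector or dominates a positive multiple of |x|². Comparing ν with β²
-- would require that no eigenvalue lies below -μ. Nikiforov's inequality bounds the square of q,
-- hence q from both sides, and so yields the operator norm directly; (i) and (ii) are proved beside
-- the bound with β and not from it.

-- Polynomial identities with integer coefficients.

module IntegerSolver {c ℓ} (R : CommutativeRing c ℓ) where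
  open CommutativeRing R
  open import Algebra.Properties.Ring ring
  open import Algebra.Properties.AbelianGroup +-abelianGroup using (⁻¹-∙-comm)
  open import Algebra.Properties.Semiring.Mult semiring
    renaming (_×_ to _·_)
  open import Relation.Binary.Reasoning.Setoid setoid

  fromℤ : ℤ → Carrier
  fromℤ (+ n)    = n · 1#
  fromℤ -[1+ n ] = - (suc n · 1#)

  private
    cancel : ∀ x y z → (x + y) + - (x + z) ≈ y + - z
    cancel x y z = begin
      (x + y) + - (x + z)     ≈⟨ +-congˡ (⁻¹-∙-comm x z) ⟨
      (x + y) + (- x + - z)   ≈⟨ +-congʳ (+-comm x y) ⟩
      (y + x) + (- x + - z)   ≈⟨ +-assoc y x _ ⟩
      y + (x + (- x + - z))   ≈⟨ +-congˡ (+-assoc x (- x) (- z)) ⟨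
      y + ((x + - x) + - z)   ≈⟨ +-congˡ (+-congʳ (-‿inverseʳ x)) ⟩
      y + (0# + - z)          ≈⟨ +-congˡ (+-identityˡ (- z)) ⟩
      y + - z                 ∎

    neg-homo : ∀ i → fromℤ (ℤ.- i) ≈ - fromℤ i
    neg-homo (+ zero)   = sym -0#≈0#
    neg-homo (+ suc n)  = refl
    neg-homo -[1+ n ]   = sym (-‿involutive _)

    ⊖-homo : ∀ m n → fromℤ (m ℤ.⊖ n) ≈ m · 1# + - (n · 1#)
    ⊖-homo zero    zero    = sym (-‿inverseʳ 0#)
    ⊖-homo zero    (suc n) = sym (+-identityˡ _)
    ⊖-homo (suc m) zero    = sym (trans (+-congˡ -0#≈0#) (+-identityʳ _))
    ⊖-homo (suc m) (suc n) = begin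
      fromℤ (suc m ℤ.⊖ suc n)          ≡⟨ ≡.cong fromℤ (ℤ.[1+m]⊖[1+n]≡m⊖n m n) ⟩
      fromℤ (m ℤ.⊖ n)                  ≈⟨ ⊖-homo m n ⟩
      m · 1# + - (n · 1#)              ≈⟨ cancel 1# _ _ ⟨
      suc m · 1# + - (suc n · 1#)      ∎

    +-homo : ∀ i j → fromℤ (i ℤ.+ j) ≈ fromℤ i + fromℤ j
    +-homo (+ m)    (+ n)    = ×-homo-+ 1# m n
    +-homo (+ m)    -[1+ n ] = ⊖-homo m (suc n)
    +-homo -[1+ m ] (+ n)    = trans (⊖-homo n (suc m)) (+-comm _ _)
    +-homo -[1+ m ] -[1+ n ] = begin
      - (suc (suc (m ℕ.+ n)) · 1#)        ≡⟨ ≡.cong (λ k → - (suc k · 1#)) (ℕ.+-suc m n) ⟨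
      - ((suc m ℕ.+ suc n) · 1#)          ≈⟨ -‿cong (×-homo-+ 1# (suc m) (suc n)) ⟩
      - (suc m · 1# + suc n · 1#)         ≈⟨ ⁻¹-∙-comm _ _ ⟨
      - (suc m · 1#) + - (suc n · 1#)     ∎

    pos*neg : ∀ m n → fromℤ (+ m ℤ.* ℤ.- + n) ≈ - (m · 1# * (n · 1#))
    pos*neg m n = begin
      fromℤ (+ m ℤ.* ℤ.- + n)     ≡⟨ ≡.cong fromℤ (ℤ.neg-distribʳ-* (+ m) (+ n)) ⟨
      fromℤ (ℤ.- (+ m ℤ.* + n))   ≡⟨ ≡.cong (λ k → fromℤ (ℤ.- k)) (ℤ.pos-* m n) ⟨
      fromℤ (ℤ.- + (m ℕ.* n))     ≈⟨ neg-homo (+ (m ℕ.* n)) ⟩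
      - ((m ℕ.* n) · 1#)          ≈⟨ -‿cong (×1-homo-* m n) ⟩
      - (m · 1# * (n · 1#))       ∎

    *-homo : ∀ i j → fromℤ (i ℤ.* j) ≈ fromℤ i * fromℤ j
    *-homo (+ m)    (+ n)    =
      trans (reflexive (≡.cong fromℤ (≡.sym (ℤ.pos-* m n)))) (×1-homo-* m n)
    *-homo (+ m)    -[1+ n ] = trans (pos*neg m (suc n)) (-‿distribʳ-* _ _)
    *-homo -[1+ m ] (+ n)    = begin
      fromℤ (-[1+ m ] ℤ.* + n)        ≡⟨ ≡.cong fromℤ (ℤ.*-comm -[1+ m ] (+ n)) ⟩
      fromℤ (+ n ℤ.* -[1+ m ])        ≈⟨ pos*neg n (suc m) ⟩
      - (n · 1# * (suc m · 1#))       ≈⟨ -‿cong (*-comm _ _) ⟩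
      - (suc m · 1# * (n · 1#))       ≈⟨ -‿distribˡ-* _ _ ⟩
      - (suc m · 1#) * (n · 1#)       ∎
    *-homo -[1+ m ] -[1+ n ] = begin
      (suc m ℕ.* suc n) · 1#                ≈⟨ ×1-homo-* (suc m) (suc n) ⟩
      suc m · 1# * (suc n · 1#)             ≈⟨ -‿involutive _ ⟨
      - - (suc m · 1# * (suc n · 1#))       ≈⟨ -‿cong (-‿distribʳ-* _ _) ⟩
      - (suc m · 1# * - (suc n · 1#))       ≈⟨ -‿distribˡ-* _ _ ⟩
      - (suc m · 1#) * - (suc n · 1#)       ∎

    -- Sending + 1 to 1# itself, and not to 1# + 0#, lets the solver read 1#.
    ⟦_⟧ : ℤ → Carrier
    ⟦ + 1 ⟧ = 1#
    ⟦ i ⟧   = fromℤ i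

    ⟦⟧≈fromℤ : ∀ i → ⟦ i ⟧ ≈ fromℤ i
    ⟦⟧≈fromℤ (+ 0)             = refl
    ⟦⟧≈fromℤ (+ 1)             = sym (+-identityʳ 1#)
    ⟦⟧≈fromℤ (+ suc (suc n))   = refl
    ⟦⟧≈fromℤ -[1+ n ]          = refl

    -- Coefficients are taken in ℤ because equality there computes; a ring known only by its axioms
    -- offers no test by which normal forms could be compared.
    homomorphism : ℤ.+-*-rawRing -Raw-AlmostCommutative⟶ fromCommutativeRing R
    homomorphism = record
      { ⟦_⟧    = ⟦_⟧
      ; +-homo = λ i j → trans (⟦⟧≈fromℤ (i ℤ.+ j))
          (trans (+-homo i j) (sym (+-cong (⟦⟧≈fromℤ i) (⟦⟧≈fromℤ j))))
      ; *-homo = λ i j → trans (⟦⟧≈fromℤ (i ℤ.* j))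
          (trans (*-homo i j) (sym (*-cong (⟦⟧≈fromℤ i) (⟦⟧≈fromℤ j))))
      ; -‿homo = λ i → trans (⟦⟧≈fromℤ (ℤ.- i))
          (trans (neg-homo i) (sym (-‿cong (⟦⟧≈fromℤ i))))
      ; 0-homo = refl
      ; 1-homo = refl
      }

  open Algebra.Solver.Ring ℤ.+-*-rawRing (fromCommutativeRing R) homomorphism
    (λ i j → Maybe.map (λ i≡j → reflexive (≡.cong ⟦_⟧ i≡j)) (dec⇒maybe (i ℤ.≟ j)))
    public using (solve; _:=_; _:+_; _:*_; _:-_; :-_; con)

-- Arithmetic of ordered fields.

module OrderedField {c ℓ₁ ℓ₂} (ℝ : CompleteOrderedField c ℓ₁ ℓ₂) where
  open CompleteOrderedField ℝ
  open RealOps ℝ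
  open IntegerSolver commutativeRing

  poset : Poset c ℓ₁ ℓ₂
  poset = record { isPartialOrder = IsDecTotalOrder.isPartialOrder isDecTotalOrder }

  module ≤-Reasoning = Relation.Binary.Reasoning.PartialOrder poset
    using (begin_; begin-equality_; step-≡-⟩; step-≡-⟨; step-≤; step-≈; step-≈-⟩; step-≈-⟨; _∎)
  open ≤-Reasoning

  infix 4 _<_
  -- For a total order this is the strict order; positivity is then proved by refuting `x ≤ 0#`.
  _<_ : Carrier → Carrier → Set ℓ₂
  x < y = ¬ (y ≤ x)

  <⇒≤ : ∀ {x y} → x < y → x ≤ y
  <⇒≤ {x} {y} x<y with total x y
  ... | inj₁ x≤y = x≤y
  ... | inj₂ y≤x = contradiction y≤x x<y

  <⇒≉ : ∀ {x} → 0# < x → ¬ (x ≈ 0#)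
  <⇒≉ 0<x x≈0 = 0<x (≤-reflexive x≈0)

  ≤∧≉⇒< : ∀ {x} → 0# ≤ x → ¬ (x ≈ 0#) → 0# < x
  ≤∧≉⇒< 0≤x x≉0 x≤0 = x≉0 (≤-antisym x≤0 0≤x)

  <-≤-trans : ∀ {x y z} → x < y → y ≤ z → x < z
  <-≤-trans x<y y≤z z≤x = x<y (≤-trans y≤z z≤x)

  <-respʳ-≈ : ∀ {x y z} → y ≈ z → x < y → x < z
  <-respʳ-≈ y≈z x<y = <-≤-trans x<y (≤-reflexive y≈z)

  x≤y⇒0≤y-x : ∀ {x y} → x ≤ y → 0# ≤ y - x
  x≤y⇒0≤y-x {x} x≤y = ≤-respˡ-≈ (-‿inverseʳ x) (+-monoˡ-≤ (- x) x≤y)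

  -- The usual way to an inequality below: the difference of the two sides is rewritten by the ring
  -- solver as an expression that is visibly nonnegative.
  ≤-from : ∀ {x y p} → 0# ≤ p → y - x ≈ p → x ≤ y
  ≤-from {x} {y} {p} 0≤p y-x≈p = begin
    x           ≈⟨ +-identityˡ x ⟨
    0# + x      ≤⟨ +-monoˡ-≤ x 0≤p ⟩
    p + x       ≈⟨ +-congʳ y-x≈p ⟨
    y - x + x   ≈⟨ solve 2 (λ x y → y :- x :+ x := y) refl x y ⟩
    y           ∎

  neg-nonNeg : ∀ {x} → x ≤ 0# → 0# ≤ - x
  neg-nonNeg {x} x≤0 = ≤-respʳ-≈ (+-identityˡ (- x)) (x≤y⇒0≤y-x x≤0)

  +-mono-≤ : ∀ {x y u v} → x ≤ y → u ≤ v → x + u ≤ y + v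
  +-mono-≤ {x} {y} {u} {v} x≤y u≤v = begin
    x + u  ≤⟨ +-monoˡ-≤ u x≤y ⟩
    y + u  ≈⟨ +-comm y u ⟩
    u + y  ≤⟨ +-monoˡ-≤ y u≤v ⟩
    v + y  ≈⟨ +-comm v y ⟩
    y + v  ∎

  +-nonNeg : ∀ {x y} → 0# ≤ x → 0# ≤ y → 0# ≤ x + y
  +-nonNeg 0≤x 0≤y = ≤-respˡ-≈ (+-identityˡ 0#) (+-mono-≤ 0≤x 0≤y)

  +-pos : ∀ {x y} → 0# < x → 0# ≤ y → 0# < x + y
  +-pos {x} 0<x 0≤y = <-≤-trans 0<x
    (≤-respˡ-≈ (+-identityʳ x) (+-mono-≤ (≤-refl {x}) 0≤y))

  *-monoˡ-≤ : ∀ {a x y} → 0# ≤ a → x ≤ y → a * x ≤ a * y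
  *-monoˡ-≤ {a} {x} {y} 0≤a x≤y = ≤-from (*-nonNeg 0≤a (x≤y⇒0≤y-x x≤y))
    (solve 3 (λ a x y → a :* y :- a :* x := a :* (y :- x)) refl a x y)

  *-monoʳ-≤ : ∀ {a x y} → 0# ≤ a → x ≤ y → x * a ≤ y * a
  *-monoʳ-≤ {a} {x} {y} 0≤a x≤y = begin
    x * a  ≈⟨ *-comm x a ⟩
    a * x  ≤⟨ *-monoˡ-≤ 0≤a x≤y ⟩
    a * y  ≈⟨ *-comm a y ⟩
    y * a  ∎

  square-nonNeg : ∀ x → 0# ≤ x * x
  square-nonNeg x with total 0# x
  ... | inj₁ 0≤x = *-nonNeg 0≤x 0≤x
  ... | inj₂ x≤0 = ≤-respʳ-≈ (solve 1 (λ x → :- x :* :- x := x :* x) refl x)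
    (*-nonNeg (neg-nonNeg x≤0) (neg-nonNeg x≤0))

  0≤1 : 0# ≤ 1#
  0≤1 = ≤-respʳ-≈ (*-identityˡ 1#) (square-nonNeg 1#)

  0<1 : 0# < 1#
  0<1 1≤0 = 0≉1 (≤-antisym 0≤1 1≤0)

  fromℕ-nonNeg : ∀ n → 0# ≤ fromℕ n
  fromℕ-nonNeg zero    = ≤-refl
  fromℕ-nonNeg (suc n) = +-nonNeg 0≤1 (fromℕ-nonNeg n)

  fromℕ-pos : ∀ {n} → 1 ℕ.≤ n → 0# < fromℕ n
  fromℕ-pos {suc n} _ = +-pos 0<1 (fromℕ-nonNeg n)

  fromℕ-mono : ∀ {m n} → m ℕ.≤ n → fromℕ m ≤ fromℕ n
  fromℕ-mono {n = n} ℕ.z≤n   = fromℕ-nonNeg n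
  fromℕ-mono (ℕ.s≤s m≤n) = +-mono-≤ ≤-refl (fromℕ-mono m≤n)

  inverse-pos : ∀ {x} → 0# < x → ∃ λ y → 0# < y × x * y ≈ 1#
  inverse-pos {x} 0<x with inverse x (<⇒≉ 0<x)
  ... | y , xy≈1 = y , 0<y , xy≈1
    where
    0<y : 0# < y
    -- Otherwise `x * - y`, which equals -1, would be nonnegative.
    0<y y≤0 = 0<1 (≤-from (*-nonNeg (<⇒≤ 0<x) (neg-nonNeg y≤0))
      (trans (+-congˡ (-‿cong (sym xy≈1)))
        (solve 2 (λ x y → con (+ 0) :- x :* y := x :* :- y) refl x y)))

  *-cancel-nonNeg : ∀ {x y} → 0# < x → 0# ≤ x * y → 0# ≤ y
  *-cancel-nonNeg {x} {y} 0<x 0≤xy =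
    let k , 0<k , xk≈1 = inverse-pos 0<x
    in ≤-respʳ-≈ (k[xy]≈y k xk≈1) (*-nonNeg (<⇒≤ 0<k) 0≤xy)
    where
    k[xy]≈y : ∀ k → x * k ≈ 1# → k * (x * y) ≈ y
    k[xy]≈y k xk≈1 = trans (solve 3 (λ k x y → k :* (x :* y) := (x :* k) :* y) refl k x y)
      (trans (*-congʳ xk≈1) (*-identityˡ y))

  *-cancelˡ-≤ : ∀ {a x y} → 0# < a → a * x ≤ a * y → x ≤ y
  *-cancelˡ-≤ {a} {x} {y} 0<a ax≤ay = ≤-from (*-cancel-nonNeg 0<a
    (≤-respʳ-≈ (solve 3 (λ a x y → a :* y :- a :* x := a :* (y :- x)) refl a x y)
      (x≤y⇒0≤y-x ax≤ay))) refl

  *-pos : ∀ {x y} → 0# < x → 0# < y → 0# < x * y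
  *-pos {x} {y} 0<x 0<y xy≤0 = 0<y (*-cancelˡ-≤ 0<x (≤-respʳ-≈ (sym (zeroʳ x)) xy≤0))

  square≤0⇒≈0 : ∀ {x} → x * x ≤ 0# → x ≈ 0#
  square≤0⇒≈0 {x} x²≤0 with x ≟ 0# | total 0# x
  ... | yes x≈0 | _        = x≈0
  ... | no  x≉0 | inj₁ 0≤x = contradiction x²≤0 (*-pos 0<x 0<x)
    where 0<x = ≤∧≉⇒< 0≤x x≉0
  ... | no  x≉0 | inj₂ x≤0 = contradiction
    (≤-respˡ-≈ (solve 1 (λ x → x :* x := :- x :* :- x) refl x) x²≤0) (*-pos 0<-x 0<-x)
    where
    0<-x : 0# < - x
    0<-x -x≤0 = x≉0 (≤-antisym x≤0 (≤-from (neg-nonNeg -x≤0)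
      (solve 1 (λ x → x :- con (+ 0) := :- (:- x)) refl x)))

  -- Since `x` may have either sign, the factor `y + x` of y² - x² can be cancelled only when it is
  -- positive; when it is not, `x ≤ y + x ≤ 0#` already suffices.
  square-cancel-≤ : ∀ {x y} → 0# ≤ y → x * x ≤ y * y → x ≤ y
  square-cancel-≤ {x} {y} 0≤y x²≤y² with (y + x) ≤? 0#
  ... | no 0<y+x = ≤-from (*-cancel-nonNeg 0<y+x
    (≤-respʳ-≈ (solve 2 (λ x y → y :* y :- x :* x := (y :+ x) :* (y :- x)) refl x y)
      (x≤y⇒0≤y-x x²≤y²))) refl
  ... | yes y+x≤0 = begin
    x       ≈⟨ +-identityˡ x ⟨
    0# + x  ≤⟨ +-monoˡ-≤ x 0≤y ⟩
    y + x   ≤⟨ y+x≤0 ⟩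
    0#      ≤⟨ 0≤y ⟩
    y       ∎

  ⁻¹-inverseʳ : ∀ {x} → ¬ (x ≈ 0#) → x * x ⁻¹ ≈ 1#
  ⁻¹-inverseʳ {x} x≉0 with x ≟ 0#
  ... | yes x≈0  = contradiction x≈0 x≉0
  ... | no  x≉0′ = proj₂ (inverse x x≉0′)

  */-cancel : ∀ {x y} → ¬ (y ≈ 0#) → (x / y) * y ≈ x
  */-cancel {x} {y} y≉0 =
    trans (solve 3 (λ x y z → x :* z :* y := x :* (y :* z)) refl x y (y ⁻¹))
      (trans (*-congˡ (⁻¹-inverseʳ y≉0)) (*-identityʳ x))

  ≤-/ : ∀ {x y z} → 0# < y → y * x ≤ z → x ≤ z / y
  ≤-/ {x} {y} {z} 0<y yx≤z = *-cancelˡ-≤ 0<y (begin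
    y * x        ≤⟨ yx≤z ⟩
    z            ≈⟨ */-cancel (<⇒≉ 0<y) ⟨
    z / y * y    ≈⟨ *-comm (z / y) y ⟩
    y * (z / y)  ∎)

  -- Cauchy-Schwarz in additive form: the condition on the triple (a, b, d) is preserved by
  -- addition, so it passes from terms to sums over any index type, and `discriminant` then extracts
  -- b² ≤ a d.
  NonNegForm : Carrier → Carrier → Carrier → Set (c ⊔ ℓ₂)
  NonNegForm a b d = ∀ s t → 0# ≤ s * s * a + fromℕ 2 * (s * t) * b + t * t * d

  NonNegForm-0# : NonNegForm 0# 0# 0#
  NonNegForm-0# s t = ≤-reflexive
    (solve 2 (λ s t → con (+ 0) := s :* s :* con (+ 0) :+ con (+ 2) :* (s :* t) :* con (+ 0)
                                     :+ t :* t :* con (+ 0)) refl s t)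

  NonNegForm-+ : ∀ {a a′ b b′ d d′} → NonNegForm a b d → NonNegForm a′ b′ d′ →
                 NonNegForm (a + a′) (b + b′) (d + d′)
  NonNegForm-+ {a} {a′} {b} {b′} {d} {d′} form form′ s t = ≤-respʳ-≈
    (solve 9 (λ p q r a a′ b b′ d d′ →
      (p :* a :+ q :* b :+ r :* d) :+ (p :* a′ :+ q :* b′ :+ r :* d′)
      := p :* (a :+ a′) :+ q :* (b :+ b′) :+ r :* (d :+ d′)) refl
      (s * s) (fromℕ 2 * (s * t)) (t * t) a a′ b b′ d d′)
    (+-nonNeg (form s t) (form′ s t))

  discriminant : ∀ {a b d} → NonNegForm a b d → b * b ≤ a * d
  discriminant {a} {b} {d} form with a ≤? 0#
  -- The value at (-b, a) is a (a d - b²).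
  ... | no 0<a = ≤-from (*-cancel-nonNeg 0<a (≤-respʳ-≈
    (solve 3 (λ a b d → :- b :* :- b :* a :+ con (+ 2) :* (:- b :* a) :* b :+ a :* a :* d
                        := a :* (a :* d :- b :* b)) refl a b d)
    (form (- b) a))) refl
  -- Here a = 0, and the value at (s, -b) is -(2s - d) b². The choice s = 1 + d makes 2s - d = 2 + d
  -- positive without a division.
  ... | yes a≤0 = ≤-from (*-cancel-nonNeg (+-pos (+-pos 0<1 0≤1) 0≤d) (≤-respʳ-≈
    (trans (+-congʳ (+-congʳ (*-congˡ a≈0)))
      (trans
        (solve 2 (λ b d → (con (+ 1) :+ d) :* (con (+ 1) :+ d) :* con (+ 0)
                   :+ con (+ 2) :* ((con (+ 1) :+ d) :* :- b) :* b :+ :- b :* :- b :* d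
                   := (con (+ 1) :+ con (+ 1) :+ d) :* (con (+ 0) :* d :- b :* b)) refl b d)
        (*-congˡ (+-congʳ (*-congʳ (sym a≈0))))))
    (form (1# + d) (- b)))) refl
    where
    a≈0 : a ≈ 0#
    a≈0 = ≤-antisym a≤0 (≤-respʳ-≈
      (solve 3 (λ a b d → con (+ 1) :* con (+ 1) :* a :+ con (+ 2) :* (con (+ 1) :* con (+ 0)) :* b
                 :+ con (+ 0) :* con (+ 0) :* d := a) refl a b d) (form 1# 0#))
    0≤d : 0# ≤ d
    0≤d = ≤-respʳ-≈
      (solve 3 (λ a b d → con (+ 0) :* con (+ 0) :* a :+ con (+ 2) :* (con (+ 0) :* con (+ 1)) :* b
                 :+ con (+ 1) :* con (+ 1) :* d := d) refl a b d) (form 0# 1#)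

  -- Square roots as suprema.

  module SquareRoot {x s : Carrier} (0≤x : 0# ≤ x)
                    (lub : IsLeastUpperBound (RootBelow x) s) where

    0≤s : 0# ≤ s
    0≤s = proj₁ lub 0# (lift (inj₁ ≤-refl))

    -- Both bounds compare s with the average (s b + x) / (s + b), which is the
    -- Newton step when b = s, through
    -- (s b + x)² − x (s + b)² = (s² − x) (b² − x).
    private
      average : ∀ b → Carrier
      average b = s * b + x

      average² : ∀ b k → (s + b) * k ≈ 1# →
                 (average b * k) * (average b * k) - x
                   ≈ (k * k) * ((s * s - x) * (b * b - x))
      average² b k [s+b]k≈1 = begin-equality
        (average b * k) * (average b * k) - x
          ≈⟨ +-congˡ (-‿cong x≈) ⟩
        (average b * k) * (average b * k) - x * (((s + b) * k) * ((s + b) * k))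
          ≈⟨ solve 4 (λ s b k x →
               ((s :* b :+ x) :* k) :* ((s :* b :+ x) :* k) :- x :* (((s :+ b) :* k) :* ((s :+ b) :* k))
               := (k :* k) :* ((s :* s :- x) :* (b :* b :- x))) refl s b k x ⟩
        (k * k) * ((s * s - x) * (b * b - x)) ∎
        where
        x≈ : x ≈ x * (((s + b) * k) * ((s + b) * k))
        x≈ = sym (trans (*-congˡ (trans (*-cong [s+b]k≈1 [s+b]k≈1) (*-identityˡ 1#)))
                        (*-identityʳ x))

      [average*k]*[s+b] : ∀ b k → (s + b) * k ≈ 1# → (s + b) * (average b * k) ≈ average b
      [average*k]*[s+b] b k [s+b]k≈1 =
        trans (solve 3 (λ u v w → u :* (v :* w) := (u :* w) :* v) refl (s + b) (average b) k)
          (trans (*-congʳ [s+b]k≈1) (*-identityˡ _))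

    x≤s*s : x ≤ s * s
    x≤s*s with total (s * s) x
    ... | inj₂ x≤s² = x≤s²
    ... | inj₁ s²≤x = let k , _ , [s+b]k≈1 = inverse-pos 0<s+b in bound k [s+b]k≈1
      where
      -- Any `b` with b² ≥ x and s + b > 0 would do; for this one b² - x = 1 + x + x².
      b = 1# + x
      0<s+b : 0# < s + b
      0<s+b = <-respʳ-≈ (+-comm b s) (+-pos (+-pos 0<1 0≤x) 0≤s)
      0≤b²-x : 0# ≤ b * b - x
      0≤b²-x = ≤-respʳ-≈
        (solve 1 (λ x → con (+ 1) :+ (x :+ x :* x)
                   := (con (+ 1) :+ x) :* (con (+ 1) :+ x) :- x) refl x)
        (+-nonNeg 0≤1 (+-nonNeg 0≤x (*-nonNeg 0≤x 0≤x)))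
      -- As s² ≤ x ≤ b², the product in `average²` is at most 0, so the average lies in the set and
      -- is at most `s`.
      y²≤x : ∀ k → (s + b) * k ≈ 1# → (average b * k) * (average b * k) ≤ x
      y²≤x k [s+b]k≈1 = ≤-from
        (*-nonNeg (square-nonNeg k) (*-nonNeg (x≤y⇒0≤y-x s²≤x) 0≤b²-x))
        (trans (solve 2 (λ u x → x :- u := :- (u :- x)) refl _ x)
          (trans (-‿cong (average² b k [s+b]k≈1))
            (solve 4 (λ k p q x → :- (k :* k :* ((p :- x) :* (q :- x)))
                        := k :* k :* ((x :- p) :* (q :- x))) refl k (s * s) (b * b) x)))
      bound : ∀ k → (s + b) * k ≈ 1# → x ≤ s * s
      bound k [s+b]k≈1 = ≤-from (x≤y⇒0≤y-x (begin
        average b                 ≈⟨ [average*k]*[s+b] b k [s+b]k≈1 ⟨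
        (s + b) * (average b * k) ≤⟨ *-monoˡ-≤ (<⇒≤ 0<s+b)
                                       (proj₁ lub _ (lift (inj₂ (y²≤x k [s+b]k≈1)))) ⟩
        (s + b) * s               ∎))
        (solve 3 (λ s b x → s :* s :- x := (s :+ b) :* s :- (s :* b :+ x)) refl s b x)

    s*s≤x : s * s ≤ x
    s*s≤x with s ≤? 0#
    -- Zero is treated apart because the Newton step divides by `s + s`.
    ... | yes s≤0 = ≤-trans (≤-reflexive (trans (*-congʳ s≈0) (zeroˡ s))) 0≤x
      where s≈0 = ≤-antisym s≤0 0≤s
    ... | no 0<s =
      let k , 0<k , [s+s]k≈1 = inverse-pos (+-pos 0<s 0≤s) in bound k 0<k [s+s]k≈1
      where
      -- For b = s the product in `average²` is a square, so the Newton step is an upper bound and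
      -- `s`, the least one, is at most it.
      upper : ∀ {k} → 0# < k → (s + s) * k ≈ 1# → IsUpperBound (RootBelow x) (average s * k)
      upper 0<k [s+s]k≈1 z (lift z∈) = root z∈
        where
        0≤y = *-nonNeg (+-nonNeg (square-nonNeg s) 0≤x) (<⇒≤ 0<k)
        root : z ≤ 0# ⊎ z * z ≤ x → z ≤ average s * _
        root (inj₁ z≤0)  = ≤-trans z≤0 0≤y
        root (inj₂ z²≤x) = square-cancel-≤ 0≤y (≤-trans z²≤x
          (≤-from (*-nonNeg (square-nonNeg _) (square-nonNeg (s * s - x)))
            (average² s _ [s+s]k≈1)))
      bound : ∀ k → 0# < k → (s + s) * k ≈ 1# → s * s ≤ x
      bound k 0<k [s+s]k≈1 = ≤-from (x≤y⇒0≤y-x (begin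
        (s + s) * s                ≤⟨ *-monoˡ-≤ (+-nonNeg 0≤s 0≤s)
                                        (proj₂ lub _ (upper 0<k [s+s]k≈1)) ⟩
        (s + s) * (average s * k)  ≈⟨ [average*k]*[s+b] s k [s+s]k≈1 ⟩
        average s                  ∎))
        (solve 2 (λ s x → x :- s :* s := (s :* s :+ x) :- (s :+ s) :* s) refl s x)

    s*s≈x : s * s ≈ x
    s*s≈x = ≤-antisym s*s≤x x≤s*s

  private
    √-lub : ∀ x → IsLeastUpperBound (RootBelow x) (√ x)
    √-lub x = proj₂ (complete (RootBelow x) (rootBelow-inhabited x) (rootBelow-bounded x))

  √-nonNeg : ∀ {x} → 0# ≤ x → 0# ≤ √ x
  √-nonNeg {x} 0≤x = SquareRoot.0≤s 0≤x (√-lub x)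

  √*√ : ∀ {x} → 0# ≤ x → √ x * √ x ≈ x
  √*√ {x} 0≤x = SquareRoot.s*s≈x 0≤x (√-lub x)

-- Finite sums and inner products.

module QuadraticForms {c ℓ₁ ℓ₂} (ℝ : CompleteOrderedField c ℓ₁ ℓ₂) where
  open CompleteOrderedField ℝ hiding (zero)
  open RealOps ℝ
  open IntegerSolver commutativeRing
  open OrderedField ℝ
  open ≤-Reasoning
  open import Algebra.Properties.Semiring.Sum semiring public
    using (sum-cong-≋; sum-replicate; ∑-distrib-+; ∑-comm; *-distribˡ-sum)

  private
    variable
      n : ℕ

  sum-nonNeg : {f : Fin n → Carrier} → (∀ i → 0# ≤ f i) → 0# ≤ sum f
  sum-nonNeg {zero}  0≤f = ≤-refl
  sum-nonNeg {suc n} 0≤f = +-nonNeg (0≤f zero) (sum-nonNeg (0≤f ∘ suc))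

  sum-mono-≤ : {f g : Fin n → Carrier} → (∀ i → f i ≤ g i) → sum f ≤ sum g
  sum-mono-≤ {zero}  f≤g = ≤-refl
  sum-mono-≤ {suc n} f≤g = +-mono-≤ (f≤g zero) (sum-mono-≤ (f≤g ∘ suc))

  term≤sum : {f : Fin n → Carrier} → (∀ i → 0# ≤ f i) → ∀ i → f i ≤ sum f
  term≤sum {f = f} 0≤f zero = ≤-respˡ-≈ (+-identityʳ (f zero))
    (+-mono-≤ ≤-refl (sum-nonNeg (0≤f ∘ suc)))
  term≤sum {f = f} 0≤f (suc i) = ≤-respˡ-≈ (+-identityˡ (f (suc i)))
    (+-mono-≤ (0≤f zero) (term≤sum (0≤f ∘ suc) i))

  sum-0# : {f : Fin n → Carrier} → (∀ i → f i ≈ 0#) → sum f ≈ 0#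
  sum-0# {zero}  f≈0 = refl
  sum-0# {suc n} f≈0 = trans (+-cong (f≈0 zero) (sum-0# (f≈0 ∘ suc))) (+-identityˡ 0#)

  sum-linear : ∀ s t (f g : Fin n → Carrier) →
               sum (λ i → s * f i + t * g i) ≈ s * sum f + t * sum g
  sum-linear s t f g = trans (∑-distrib-+ (λ i → s * f i) (λ i → t * g i))
    (sym (+-cong (*-distribˡ-sum s f) (*-distribˡ-sum t g)))

  sum-NonNegForm : {f g h : Fin n → Carrier} →
                   (∀ i → NonNegForm (f i) (g i) (h i)) → NonNegForm (sum f) (sum g) (sum h)
  sum-NonNegForm {zero}  form = NonNegForm-0#
  sum-NonNegForm {suc n} form = NonNegForm-+ (form zero) (sum-NonNegForm (form ∘ suc))

  infix 8 ⟨_,_⟩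
  ⟨_,_⟩ : (x y : Fin n → Carrier) → Carrier
  ⟨ x , y ⟩ = sum (λ i → x i * y i)

  ∥_∥² : (Fin n → Carrier) → Carrier
  ∥ x ∥² = ⟨ x , x ⟩

  ⟨⟩-comm : (x y : Fin n → Carrier) → ⟨ x , y ⟩ ≈ ⟨ y , x ⟩
  ⟨⟩-comm x y = sum-cong-≋ (λ i → *-comm (x i) (y i))

  ⟨⟩-congʳ : (x : Fin n → Carrier) {y z : Fin n → Carrier} → (∀ i → y i ≈ z i) →
             ⟨ x , y ⟩ ≈ ⟨ x , z ⟩
  ⟨⟩-congʳ x y≈z = sum-cong-≋ (λ i → *-congˡ (y≈z i))

  combine : (s : Carrier) (x : Fin n → Carrier) (t : Carrier) (y : Fin n → Carrier) →
            Fin n → Carrier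
  combine s x t y i = s * x i + t * y i

  ⟨⟩-linearʳ : ∀ s t (x y z : Fin n → Carrier) →
               ⟨ x , combine s y t z ⟩ ≈ s * ⟨ x , y ⟩ + t * ⟨ x , z ⟩
  ⟨⟩-linearʳ s t x y z = trans
    (sum-cong-≋ (λ i → solve 5 (λ x s y t z → x :* (s :* y :+ t :* z)
                                  := s :* (x :* y) :+ t :* (x :* z)) refl (x i) s (y i) t (z i)))
    (sum-linear s t (λ i → x i * y i) (λ i → x i * z i))

  ⟨⟩-linearˡ : ∀ s t (x y z : Fin n → Carrier) →
               ⟨ combine s x t y , z ⟩ ≈ s * ⟨ x , z ⟩ + t * ⟨ y , z ⟩
  ⟨⟩-linearˡ s t x y z = trans (⟨⟩-comm (combine s x t y) z)
    (trans (⟨⟩-linearʳ s t z x y)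
      (+-cong (*-congˡ (⟨⟩-comm z x)) (*-congˡ (⟨⟩-comm z y))))

  ⟨⟩-zeroʳ : (x : Fin n → Carrier) {y : Fin n → Carrier} → (∀ i → y i ≈ 0#) →
             ⟨ x , y ⟩ ≈ 0#
  ⟨⟩-zeroʳ x y≈0 = sum-0# (λ i → trans (*-congˡ (y≈0 i)) (zeroʳ (x i)))

  ∥∥²-nonNeg : (x : Fin n → Carrier) → 0# ≤ ∥ x ∥²
  ∥∥²-nonNeg x = sum-nonNeg (λ i → square-nonNeg (x i))

  ∥∥²≤0⇒≈0 : {x : Fin n → Carrier} → ∥ x ∥² ≤ 0# → ∀ i → x i ≈ 0#
  ∥∥²≤0⇒≈0 {x = x} ∥x∥²≤0 i =
    square≤0⇒≈0 (≤-trans (term≤sum (λ j → square-nonNeg (x j)) i) ∥x∥²≤0)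

  nonzero⇒0<∥∥² : {x : Fin n → Carrier} {i : Fin n} → ¬ (x i ≈ 0#) → 0# < ∥ x ∥²
  nonzero⇒0<∥∥² {i = i} xᵢ≉0 ∥x∥²≤0 = xᵢ≉0 (∥∥²≤0⇒≈0 ∥x∥²≤0 i)

  cauchy-schwarz : (x y : Fin n → Carrier) → ⟨ x , y ⟩ * ⟨ x , y ⟩ ≤ ∥ x ∥² * ∥ y ∥²
  cauchy-schwarz x y = discriminant (sum-NonNegForm (λ i s t → ≤-respʳ-≈
    (solve 4 (λ s t x y → (s :* x :+ t :* y) :* (s :* x :+ t :* y)
               := s :* s :* (x :* x) :+ con (+ 2) :* (s :* t) :* (x :* y) :+ t :* t :* (y :* y))
       refl s t (x i) (y i))
    (square-nonNeg (s * x i + t * y i))))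

  -- The Kronecker delta, by recursion and not by an equality test, so that inner products with it
  -- unfold along the recursion of `sum`.
  basis : Fin n → Fin n → Carrier
  basis zero    zero    = 1#
  basis zero    (suc j) = 0#
  basis (suc i) zero    = 0#
  basis (suc i) (suc j) = basis i j

  basis-nonNeg : (i j : Fin n) → 0# ≤ basis i j
  basis-nonNeg zero    zero    = 0≤1
  basis-nonNeg zero    (suc j) = ≤-refl
  basis-nonNeg (suc i) zero    = ≤-refl
  basis-nonNeg (suc i) (suc j) = basis-nonNeg i j

  basis-≡ : (i : Fin n) → basis i i ≡ 1#
  basis-≡ zero    = ≡.refl
  basis-≡ (suc i) = basis-≡ i

  basis-≢ : {i j : Fin n} → i ≢ j → basis i j ≡ 0#
  basis-≢ {i = zero}  {zero}  i≢j = contradiction ≡.refl i≢j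
  basis-≢ {i = zero}  {suc j} i≢j = ≡.refl
  basis-≢ {i = suc i} {zero}  i≢j = ≡.refl
  basis-≢ {i = suc i} {suc j} i≢j = basis-≢ (i≢j ∘ ≡.cong suc)

  basis-sym : (i j : Fin n) → basis i j ≡ basis j i
  basis-sym zero    zero    = ≡.refl
  basis-sym zero    (suc j) = ≡.refl
  basis-sym (suc i) zero    = ≡.refl
  basis-sym (suc i) (suc j) = basis-sym i j

  ⟨basis,⟩ : (i : Fin n) (x : Fin n → Carrier) → ⟨ basis i , x ⟩ ≈ x i
  ⟨basis,⟩ zero x = trans
    (+-cong (*-identityˡ (x zero)) (sum-0# (λ j → zeroˡ (x (suc j))))) (+-identityʳ (x zero))
  ⟨basis,⟩ (suc i) x = trans
    (+-cong (zeroˡ (x zero)) (⟨basis,⟩ i (x ∘ suc))) (+-identityˡ (x (suc i)))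

  -- Quadratic forms of symmetric matrices.

  infixl 8 _*ᵥ_
  _*ᵥ_ : Matrix n → (Fin n → Carrier) → Fin n → Carrier
  (Q *ᵥ x) i = ⟨ Q i , x ⟩

  form : Matrix n → (Fin n → Carrier) → Carrier
  form Q x = ⟨ x , Q *ᵥ x ⟩

  form-eigenvector : (A : Matrix n) {t : Carrier} {x : Fin n → Carrier} →
                     (∀ i → (A *ᵥ x) i ≈ t * x i) → form A x ≈ t * ∥ x ∥²
  form-eigenvector A {t} {x} Ax≈tx = trans
    (sum-cong-≋ (λ i → trans (*-congˡ (Ax≈tx i))
      (solve 2 (λ x t → x :* (t :* x) := t :* (x :* x)) refl (x i) t)))
    (sym (*-distribˡ-sum t (λ i → x i * x i)))

  IsSymmetric : Matrix n → Set ℓ₁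
  IsSymmetric Q = ∀ i j → Q i j ≈ Q j i

  PositiveSemidefinite : Matrix n → Set (c ⊔ ℓ₂)
  PositiveSemidefinite Q = ∀ x → 0# ≤ form Q x

  *ᵥ-symmetric : {Q : Matrix n} → IsSymmetric Q → ∀ x y → ⟨ x , Q *ᵥ y ⟩ ≈ ⟨ y , Q *ᵥ x ⟩
  *ᵥ-symmetric {Q = Q} Q-sym x y = begin-equality
    sum (λ i → x i * sum (λ j → Q i j * y j))
      ≈⟨ sum-cong-≋ (λ i → *-distribˡ-sum (x i) (λ j → Q i j * y j)) ⟩
    sum (λ i → sum (λ j → x i * (Q i j * y j)))
      ≈⟨ ∑-comm (λ i j → x i * (Q i j * y j)) ⟩
    sum (λ j → sum (λ i → x i * (Q i j * y j)))
      ≈⟨ sum-cong-≋ (λ j → sum-cong-≋ (λ i → trans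
           (solve 3 (λ x q y → x :* (q :* y) := y :* (q :* x)) refl (x i) (Q i j) (y j))
           (*-congˡ (*-congʳ (Q-sym i j))))) ⟩
    sum (λ j → sum (λ i → y j * (Q j i * x i)))
      ≈⟨ sum-cong-≋ (λ j → *-distribˡ-sum (y j) (λ i → Q j i * x i)) ⟨
    sum (λ j → y j * sum (λ i → Q j i * x i)) ∎

  form-combine : {Q : Matrix n} → IsSymmetric Q → ∀ s t x y →
                 form Q (combine s x t y)
                   ≈ s * s * form Q x + fromℕ 2 * (s * t) * ⟨ x , Q *ᵥ y ⟩ + t * t * form Q y
  form-combine {Q = Q} Q-sym s t x y = begin-equality
    ⟨ z , Q *ᵥ z ⟩
      ≈⟨ ⟨⟩-congʳ z (λ i → ⟨⟩-linearʳ s t (Q i) x y) ⟩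
    ⟨ z , combine s (Q *ᵥ x) t (Q *ᵥ y) ⟩
      ≈⟨ ⟨⟩-linearʳ s t z _ _ ⟩
    s * ⟨ z , Q *ᵥ x ⟩ + t * ⟨ z , Q *ᵥ y ⟩
      ≈⟨ +-cong (*-congˡ (⟨⟩-linearˡ s t x y _)) (*-congˡ (⟨⟩-linearˡ s t x y _)) ⟩
    s * (s * form Q x + t * ⟨ y , Q *ᵥ x ⟩) + t * (s * ⟨ x , Q *ᵥ y ⟩ + t * form Q y)
      ≈⟨ +-congʳ (*-congˡ (+-congˡ (*-congˡ (*ᵥ-symmetric Q-sym y x)))) ⟩
    s * (s * form Q x + t * ⟨ x , Q *ᵥ y ⟩) + t * (s * ⟨ x , Q *ᵥ y ⟩ + t * form Q y)
      ≈⟨ solve 5 (λ s t a b d → s :* (s :* a :+ t :* b) :+ t :* (s :* b :+ t :* d)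
           := s :* s :* a :+ con (+ 2) :* (s :* t) :* b :+ t :* t :* d)
           refl s t (form Q x) ⟨ x , Q *ᵥ y ⟩ (form Q y) ⟩
    s * s * form Q x + fromℕ 2 * (s * t) * ⟨ x , Q *ᵥ y ⟩ + t * t * form Q y ∎
    where z = combine s x t y

  semidefinite-cauchy : {Q : Matrix n} → IsSymmetric Q → PositiveSemidefinite Q → ∀ x y →
                        ⟨ x , Q *ᵥ y ⟩ * ⟨ x , Q *ᵥ y ⟩ ≤ form Q x * form Q y
  semidefinite-cauchy Q-sym Q-psd x y = discriminant (λ s t →
    ≤-respʳ-≈ (form-combine Q-sym s t x y) (Q-psd (combine s x t y)))

  -- Cauchy-Schwarz for the semi-inner product of `Q`, applied to `Q *ᵥ x` and `x`: the left side is
  -- |Qx|⁴, and the right side contains the factor `form Q x`.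
  isotropic⇒null : {Q : Matrix n} → IsSymmetric Q → PositiveSemidefinite Q →
                   ∀ {x} → form Q x ≈ 0# → ∀ i → (Q *ᵥ x) i ≈ 0#
  isotropic⇒null {Q = Q} Q-sym Q-psd {x} Qx≈0 = ∥∥²≤0⇒≈0 (≤-reflexive (square≤0⇒≈0 (begin
    ∥ Q *ᵥ x ∥² * ∥ Q *ᵥ x ∥²     ≤⟨ semidefinite-cauchy Q-sym Q-psd (Q *ᵥ x) x ⟩
    form Q (Q *ᵥ x) * form Q x    ≈⟨ *-congˡ Qx≈0 ⟩
    form Q (Q *ᵥ x) * 0#          ≈⟨ zeroʳ _ ⟩
    0#                            ∎)))

  -- Elimination in positive semidefinite matrices.

  NullVector : Matrix n → Set (c ⊔ ℓ₁)
  NullVector {n} Q = ∃ λ (x : Fin n → Carrier) →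
    (∃ λ i → ¬ (x i ≈ 0#)) × (∀ i → (Q *ᵥ x) i ≈ 0#)

  -- A quantitative substitute for saying that all eigenvalues are positive: they are at least 1/D.
  Coercive : Matrix n → Set (c ⊔ ℓ₂)
  Coercive Q = ∃ λ D → 0# < D × (∀ x → ∥ x ∥² ≤ D * form Q x)

  module SchurComplement (Q : Matrix (suc n)) (Q-sym : IsSymmetric Q) where
    corner : Carrier
    corner = Q zero zero

    edge : Fin n → Carrier
    edge j = Q zero (suc j)

    minor : Matrix n
    minor i j = Q (suc i) (suc j)

    form-split : ∀ x → form Q x ≈ corner * (x zero * x zero)
                   + fromℕ 2 * (x zero * ⟨ edge , tail x ⟩) + form minor (tail x)
    form-split x = begin-equality
      x₀ * (corner * x₀ + ⟨ edge , y ⟩) + ⟨ y , (λ i → Q (suc i) zero * x₀ + (minor *ᵥ y) i) ⟩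
        ≈⟨ +-congˡ (⟨⟩-congʳ y (λ i → +-cong
             (trans (*-congʳ (Q-sym (suc i) zero)) (*-comm (edge i) x₀))
             (sym (*-identityˡ _)))) ⟩
      x₀ * (corner * x₀ + ⟨ edge , y ⟩) + ⟨ y , combine x₀ edge 1# (minor *ᵥ y) ⟩
        ≈⟨ +-congˡ (⟨⟩-linearʳ x₀ 1# y edge _) ⟩
      x₀ * (corner * x₀ + ⟨ edge , y ⟩) + (x₀ * ⟨ y , edge ⟩ + 1# * form minor y)
        ≈⟨ +-congˡ (+-congʳ (*-congˡ (⟨⟩-comm y edge))) ⟩
      x₀ * (corner * x₀ + ⟨ edge , y ⟩) + (x₀ * ⟨ edge , y ⟩ + 1# * form minor y)
        ≈⟨ solve 4 (λ x a β f → x :* (a :* x :+ β) :+ (x :* β :+ con (+ 1) :* f)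
             := a :* (x :* x) :+ con (+ 2) :* (x :* β) :+ f) refl x₀ corner _ _ ⟩
      corner * (x₀ * x₀) + fromℕ 2 * (x₀ * ⟨ edge , y ⟩) + form minor y ∎
      where
      x₀ = x zero
      y = tail x

    form-basis : form Q (basis zero) ≈ corner
    form-basis = trans (⟨basis,⟩ zero (Q *ᵥ basis zero))
      (trans (⟨⟩-comm (Q zero) (basis zero)) (⟨basis,⟩ zero (Q zero)))

    -- The corner is the value of the form at the first basis vector, which semidefiniteness makes
    -- isotropic here.
    null-corner : PositiveSemidefinite Q → corner ≤ 0# → NullVector Q
    null-corner Q-psd corner≤0 =
      basis zero , (zero , <⇒≉ 0<1) , isotropic⇒null Q-sym Q-psd {basis zero}
        (≤-antisym (≤-respˡ-≈ (sym form-basis) corner≤0) (Q-psd (basis zero)))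

    module Pivot {k : Carrier} (0<k : 0# < k) (ak≈1 : corner * k ≈ 1#) where
      complement : Matrix n
      complement i j = minor i j + - k * (edge i * edge j)

      complement-sym : IsSymmetric complement
      complement-sym i j = +-cong (Q-sym (suc i) (suc j)) (*-congˡ (*-comm (edge i) (edge j)))

      complement-*ᵥ : ∀ y i → (complement *ᵥ y) i
                        ≈ (minor *ᵥ y) i + - k * (edge i * ⟨ edge , y ⟩)
      complement-*ᵥ y i = begin-equality
        ⟨ complement i , y ⟩
          ≈⟨ sum-cong-≋ (λ j → solve 5 (λ m k p q y → (m :+ :- k :* (p :* q)) :* y
               := con (+ 1) :* (m :* y) :+ (:- k :* p) :* (q :* y))
               refl (minor i j) k (edge i) (edge j) (y j)) ⟩
        sum (λ j → 1# * (minor i j * y j) + (- k * edge i) * (edge j * y j))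
          ≈⟨ sum-linear 1# (- k * edge i) (λ j → minor i j * y j) (λ j → edge j * y j) ⟩
        1# * (minor *ᵥ y) i + (- k * edge i) * ⟨ edge , y ⟩
          ≈⟨ +-cong (*-identityˡ _) (*-assoc (- k) (edge i) _) ⟩
        (minor *ᵥ y) i + - k * (edge i * ⟨ edge , y ⟩) ∎

      complement-form : ∀ y → form complement y
                          ≈ form minor y + - k * (⟨ edge , y ⟩ * ⟨ edge , y ⟩)
      complement-form y = begin-equality
        ⟨ y , complement *ᵥ y ⟩
          ≈⟨ sum-cong-≋ (λ i → trans (*-congˡ (complement-*ᵥ y i))
               (solve 5 (λ y m k p β → y :* (m :+ :- k :* (p :* β))
                 := con (+ 1) :* (y :* m) :+ (:- k :* β) :* (p :* y))
                 refl (y i) ((minor *ᵥ y) i) k (edge i) ⟨ edge , y ⟩)) ⟩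
        sum (λ i → 1# * (y i * (minor *ᵥ y) i) + (- k * ⟨ edge , y ⟩) * (edge i * y i))
          ≈⟨ sum-linear 1# (- k * ⟨ edge , y ⟩) (λ i → y i * (minor *ᵥ y) i) (λ i → edge i * y i) ⟩
        1# * form minor y + (- k * ⟨ edge , y ⟩) * ⟨ edge , y ⟩
          ≈⟨ +-cong (*-identityˡ _) (*-assoc (- k) _ _) ⟩
        form minor y + - k * (⟨ edge , y ⟩ * ⟨ edge , y ⟩) ∎

      pivot : (Fin (suc n) → Carrier) → Carrier
      pivot x = x zero + k * ⟨ edge , tail x ⟩

      completed-square : ∀ x → form Q x ≈ corner * (pivot x * pivot x) + form complement (tail x)
      completed-square x = begin-equality
        form Q x
          ≈⟨ form-split x ⟩
        corner * (x₀ * x₀) + fromℕ 2 * (x₀ * β) + f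
          ≈⟨ solve 5 (λ a k x β f → a :* (x :* x) :+ con (+ 2) :* (x :* β) :+ f
               := a :* (x :* x) :+ (con (+ 1) :* (con (+ 2) :* (x :* β)) :+ con (+ 1) :* (k :* (β :* β)))
                    :+ (f :+ :- k :* (β :* β))) refl corner k x₀ β f ⟩
        -- The term k β² is added and subtracted; the factors `1#` are there to be replaced by
        -- `corner * k`.
        corner * (x₀ * x₀) + (1# * (fromℕ 2 * (x₀ * β)) + 1# * (k * (β * β)))
          + (f + - k * (β * β))
          ≈⟨ +-cong (+-congˡ (+-cong (*-congʳ (sym ak≈1)) (*-congʳ (sym ak≈1))))
               (sym (complement-form y)) ⟩
        corner * (x₀ * x₀) + (corner * k * (fromℕ 2 * (x₀ * β)) + corner * k * (k * (β * β)))
          + form complement y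
          ≈⟨ +-congʳ (solve 4 (λ a k x β →
               a :* (x :* x) :+ (a :* k :* (con (+ 2) :* (x :* β)) :+ a :* k :* (k :* (β :* β)))
               := a :* ((x :+ k :* β) :* (x :+ k :* β))) refl corner k x₀ β) ⟩
        corner * (pivot x * pivot x) + form complement y ∎
        where
        x₀ = x zero
        y = tail x
        β = ⟨ edge , y ⟩
        f = form minor y

      -- The first coordinate is chosen to make `pivot` vanish, so that only the form of the
      -- complement remains; semidefiniteness passes down along this map and null vectors pass up.
      lift-vector : (Fin n → Carrier) → Fin (suc n) → Carrier
      lift-vector y = - (k * ⟨ edge , y ⟩) Vector.∷ y

      form-lift : ∀ y → form Q (lift-vector y) ≈ form complement y
      form-lift y = begin-equality
        form Q (lift-vector y)
          ≈⟨ completed-square (lift-vector y) ⟩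
        corner * (u * u) + form complement y
          ≈⟨ +-congʳ (trans (*-congˡ (*-congʳ (-‿inverseˡ _)))
               (solve 2 (λ a u → a :* (con (+ 0) :* u) := con (+ 0)) refl corner u)) ⟩
        0# + form complement y
          ≈⟨ +-identityˡ _ ⟩
        form complement y ∎
        where u = pivot (lift-vector y)

      complement-psd : PositiveSemidefinite Q → PositiveSemidefinite complement
      complement-psd Q-psd y = ≤-respʳ-≈ (form-lift y) (Q-psd (lift-vector y))

      null-extend : NullVector complement → NullVector Q
      null-extend (y , (i , yᵢ≉0) , Sy≈0) = lift-vector y , (suc i , yᵢ≉0) , Qx≈0
        where
        β = ⟨ edge , y ⟩
        Qx≈0 : ∀ j → (Q *ᵥ lift-vector y) j ≈ 0#
        Qx≈0 zero = begin-equality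
          corner * - (k * β) + β          ≈⟨ solve 3 (λ a k β → a :* (:- (k :* β)) :+ β
                                               := con (+ 1) :* β :- (a :* k) :* β) refl corner k β ⟩
          1# * β - (corner * k) * β       ≈⟨ +-congˡ (-‿cong (*-congʳ ak≈1)) ⟩
          1# * β - 1# * β                 ≈⟨ -‿inverseʳ _ ⟩
          0#                              ∎
        Qx≈0 (suc j) = begin-equality
          Q (suc j) zero * - (k * β) + (minor *ᵥ y) j
            ≈⟨ +-congʳ (*-congʳ (Q-sym (suc j) zero)) ⟩
          edge j * - (k * β) + (minor *ᵥ y) j
            ≈⟨ solve 4 (λ p k β m → p :* (:- (k :* β)) :+ m := m :+ :- k :* (p :* β))
                 refl (edge j) k β _ ⟩
          (minor *ᵥ y) j + - k * (edge j * β)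
            ≈⟨ complement-*ᵥ y j ⟨
          (complement *ᵥ y) j
            ≈⟨ Sy≈0 j ⟩
          0# ∎

      coercive-extend : PositiveSemidefinite complement → 0# < corner →
                        Coercive complement → Coercive Q
      coercive-extend S-psd 0<a (D , 0<D , coercive) =
        -- With u = x₀ + kβ one has x₀² ≤ 2u² + 2k²β², and β² ≤ B |y|², so |x|² ≤ 2u² + L |y|². Now
        -- u² is k times a u², and |y|² ≤ D F; enlarging both coefficients to their sum gives a
        -- multiple of a u² + F, the completed square.
        fromℕ 2 * k + L * D ,
        +-pos (*-pos (fromℕ-pos {2} (ℕ.s≤s ℕ.z≤n)) 0<k) (*-nonNeg 0≤L (<⇒≤ 0<D)) ,
        bound
        where
        0≤2 = fromℕ-nonNeg 2
        B = ∥ edge ∥²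
        K = k * k * B
        0≤K : 0# ≤ K
        0≤K = *-nonNeg (square-nonNeg k) (∥∥²-nonNeg edge)
        L = fromℕ 2 * K + 1#
        0≤L : 0# ≤ L
        0≤L = +-nonNeg (*-nonNeg 0≤2 0≤K) 0≤1
        bound : ∀ x → ∥ x ∥² ≤ (fromℕ 2 * k + L * D) * form Q x
        bound x = begin
          x₀ * x₀ + w
            ≤⟨ ≤-from (square-nonNeg (u + k * β))
                 (solve 4 (λ x k β w →
                    (con (+ 2) :* ((x :+ k :* β) :* (x :+ k :* β)) :+ (con (+ 2) :* (k :* k :* (β :* β)) :+ w))
                      :- (x :* x :+ w)
                    := ((x :+ k :* β) :+ k :* β) :* ((x :+ k :* β) :+ k :* β)) refl x₀ k β w) ⟩
          fromℕ 2 * (u * u) + (fromℕ 2 * (k * k * (β * β)) + w)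
            ≤⟨ +-mono-≤ ≤-refl (+-mono-≤ (*-monoˡ-≤ 0≤2
                 (*-monoˡ-≤ (square-nonNeg k) (cauchy-schwarz edge y))) ≤-refl) ⟩
          fromℕ 2 * (u * u) + (fromℕ 2 * (k * k * (B * w)) + w)
            ≈⟨ +-congˡ (solve 3 (λ k B w → con (+ 2) :* (k :* k :* (B :* w)) :+ w
                 := (con (+ 2) :* (k :* k :* B) :+ con (+ 1)) :* w) refl k B w) ⟩
          fromℕ 2 * (u * u) + L * w
            ≤⟨ +-mono-≤ ≤-refl (*-monoˡ-≤ 0≤L (coercive y)) ⟩
          fromℕ 2 * (u * u) + L * (D * F)
            ≈⟨ +-congʳ (*-congˡ (trans (sym (*-identityˡ _)) (*-congʳ (sym ak≈1)))) ⟩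
          fromℕ 2 * (corner * k * (u * u)) + L * (D * F)
            ≤⟨ ≤-from
                 (+-nonNeg (*-nonNeg 0≤2 (*-nonNeg (<⇒≤ 0<k) (S-psd y)))
                   (*-nonNeg (*-nonNeg 0≤L (<⇒≤ 0<D)) (*-nonNeg (<⇒≤ 0<a) (square-nonNeg u))))
                 (solve 6 (λ a k L D F v →
                   (con (+ 2) :* k :+ L :* D) :* (a :* v :+ F)
                     :- (con (+ 2) :* (a :* k :* v) :+ L :* (D :* F))
                   := con (+ 2) :* (k :* F) :+ L :* D :* (a :* v)) refl corner k L D F (u * u)) ⟩
          (fromℕ 2 * k + L * D) * (corner * (u * u) + F)
            ≈⟨ *-congˡ (completed-square x) ⟨
          (fromℕ 2 * k + L * D) * form Q x ∎
          where
          x₀ = x zero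
          y = tail x
          w = ∥ y ∥²
          β = ⟨ edge , y ⟩
          u = pivot x
          F = form complement y

  -- Symmetric Gaussian elimination: a pivot that is not positive already yields a null vector, and
  -- past a positive pivot both alternatives lift from the Schur complement.
  null-or-coercive : (Q : Matrix n) → IsSymmetric Q → PositiveSemidefinite Q →
                     NullVector Q ⊎ Coercive Q
  null-or-coercive {zero}  Q Q-sym Q-psd =
    inj₂ (1# , 0<1 , λ _ → ≤-reflexive (sym (zeroʳ 1#)))
  null-or-coercive {suc n} Q Q-sym Q-psd with Q zero zero ≤? 0#
  ... | yes a≤0 = inj₁ (SchurComplement.null-corner Q Q-sym Q-psd a≤0)
  ... | no  0<a = let k , 0<k , ak≈1 = inverse-pos 0<a in eliminate k 0<k ak≈1
    where
    eliminate : ∀ k → 0# < k → Q zero zero * k ≈ 1# → NullVector Q ⊎ Coercive Q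
    eliminate k 0<k ak≈1 =
      Sum.map null-extend (coercive-extend S-psd 0<a)
        (null-or-coercive complement complement-sym S-psd)
      where
      open SchurComplement.Pivot Q Q-sym 0<k ak≈1
      S-psd = complement-psd Q-psd

  -- The largest eigenvalue as a supremum.

  scalar-minus : Carrier → Matrix n → Matrix n
  scalar-minus t A i j = t * basis i j - A i j

  scalar-minus-*ᵥ : ∀ t (A : Matrix n) x i → (scalar-minus t A *ᵥ x) i ≈ t * x i - (A *ᵥ x) i
  scalar-minus-*ᵥ t A x i = begin-equality
    sum (λ j → (t * basis i j - A i j) * x j)
      ≈⟨ sum-cong-≋ (λ j → solve 4 (λ t e a x → (t :* e :- a) :* x
           := t :* (e :* x) :+ (:- con (+ 1)) :* (a :* x)) refl t (basis i j) (A i j) (x j)) ⟩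
    sum (λ j → t * (basis i j * x j) + - 1# * (A i j * x j))
      ≈⟨ sum-linear t (- 1#) (λ j → basis i j * x j) (λ j → A i j * x j) ⟩
    t * ⟨ basis i , x ⟩ + - 1# * (A *ᵥ x) i
      ≈⟨ +-congʳ (*-congˡ (⟨basis,⟩ i x)) ⟩
    t * x i + - 1# * (A *ᵥ x) i
      ≈⟨ solve 2 (λ p q → p :+ (:- con (+ 1)) :* q := p :- q) refl _ _ ⟩
    t * x i - (A *ᵥ x) i ∎

  scalar-minus-form : ∀ t (A : Matrix n) x → form (scalar-minus t A) x ≈ t * ∥ x ∥² - form A x
  scalar-minus-form t A x = begin-equality
    ⟨ x , scalar-minus t A *ᵥ x ⟩
      ≈⟨ sum-cong-≋ (λ i → trans (*-congˡ (scalar-minus-*ᵥ t A x i))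
           (solve 3 (λ t x v → x :* (t :* x :- v)
             := t :* (x :* x) :+ (:- con (+ 1)) :* (x :* v)) refl t (x i) _)) ⟩
    sum (λ i → t * (x i * x i) + - 1# * (x i * (A *ᵥ x) i))
      ≈⟨ sum-linear t (- 1#) (λ i → x i * x i) (λ i → x i * (A *ᵥ x) i) ⟩
    t * ∥ x ∥² + - 1# * form A x
      ≈⟨ solve 2 (λ p q → p :+ (:- con (+ 1)) :* q := p :- q) refl _ _ ⟩
    t * ∥ x ∥² - form A x ∎

  -- The supremum t of the Rayleigh quotients of A is an eigenvalue: t I − A is
  -- positive semidefinite, and if it had no null vector it would be coercive,
  -- so that a number below t would still bound all the quotients.
  module Rayleigh (A : Matrix n) (A-sym : IsSymmetric A)
                  {C : Carrier} (A≤C : ∀ x → form A x ≤ C * ∥ x ∥²)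
                  {v : Fin n → Carrier} (0<∥v∥² : 0# < ∥ v ∥²) where
    -- The downward closure of the set of Rayleigh quotients: it has the same supremum, and
    -- membership involves no division. `Lift` brings it to the universe level that `complete`
    -- expects.
    BelowQuotient : Carrier → Set (c ⊔ ℓ₁ ⊔ ℓ₂)
    BelowQuotient t = Lift (c ⊔ ℓ₁ ⊔ ℓ₂)
      (∃ λ (x : Fin n → Carrier) → 0# < ∥ x ∥² × t * ∥ x ∥² ≤ form A x)

    private
      quotient : ∀ {x} → 0# < ∥ x ∥² → BelowQuotient (form A x / ∥ x ∥²)
      quotient {x} 0<∥x∥² = lift (x , 0<∥x∥² , ≤-reflexive (*/-cancel (<⇒≉ 0<∥x∥²)))

      bounded : IsUpperBound BelowQuotient C
      bounded t (lift (x , 0<∥x∥² , t≤)) = *-cancelˡ-≤ 0<∥x∥² (begin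
        ∥ x ∥² * t   ≈⟨ *-comm _ t ⟩
        t * ∥ x ∥²   ≤⟨ t≤ ⟩
        form A x     ≤⟨ A≤C x ⟩
        C * ∥ x ∥²   ≈⟨ *-comm C _ ⟩
        ∥ x ∥² * C   ∎)

      module Supremum {t : Carrier} (lub : IsLeastUpperBound BelowQuotient t) where
        form≤t : ∀ x → form A x ≤ t * ∥ x ∥²
        form≤t x with ∥ x ∥² ≤? 0#
        ... | no 0<∥x∥² = begin
          form A x                       ≈⟨ */-cancel (<⇒≉ 0<∥x∥²) ⟨
          form A x / ∥ x ∥² * ∥ x ∥²     ≤⟨ *-monoʳ-≤ (<⇒≤ 0<∥x∥²) (proj₁ lub _ (quotient 0<∥x∥²)) ⟩
          t * ∥ x ∥²                     ∎
        ... | yes ∥x∥²≤0 = ≤-reflexive (begin-equality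
          form A x                       ≈⟨ ⟨⟩-comm x (A *ᵥ x) ⟩
          ⟨ A *ᵥ x , x ⟩                 ≈⟨ ⟨⟩-zeroʳ (A *ᵥ x) (∥∥²≤0⇒≈0 ∥x∥²≤0) ⟩
          0#                             ≈⟨ zeroʳ t ⟨
          t * 0#                         ≈⟨ *-congˡ (≤-antisym ∥x∥²≤0 (∥∥²-nonNeg x)) ⟨
          t * ∥ x ∥²                     ∎)

        -- Coercivity with constant `D` reads q(x) ≤ (t - 1/D) |x|², so `t - k` with `k` the inverse
        -- of `D` would be an upper bound too.
        not-coercive : ¬ Coercive (scalar-minus t A)
        not-coercive (D , 0<D , coercive) = let k , 0<k , Dk≈1 = inverse-pos 0<D in
          0<k (≤-from (x≤y⇒0≤y-x (proj₂ lub (t - k) (upper k Dk≈1)))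
            (solve 2 (λ t k → con (+ 0) :- k := t :- k :- t) refl t k))
          where
          upper : ∀ k → D * k ≈ 1# → IsUpperBound BelowQuotient (t - k)
          upper k Dk≈1 r (lift (x , 0<w , r≤)) =
            *-cancelˡ-≤ (*-pos 0<D 0<w) (≤-from (x≤y⇒0≤y-x (begin
              w                        ≤⟨ coercive x ⟩
              D * form _ x             ≈⟨ *-congˡ (scalar-minus-form t A x) ⟩
              D * (t * w - form A x)   ≤⟨ *-monoˡ-≤ (<⇒≤ 0<D) (≤-from (x≤y⇒0≤y-x r≤)
                                            (solve 4 (λ t w r f → (t :* w :- r :* w) :- (t :* w :- f)
                                              := f :- r :* w) refl t w r (form A x))) ⟩
              D * (t * w - r * w)      ∎))
              (begin-equality
                D * w * (t - k) - D * w * r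
                  ≈⟨ solve 5 (λ D w t k r → D :* w :* (t :- k) :- D :* w :* r
                       := D :* (t :* w :- r :* w) :- (D :* k) :* w) refl D w t k r ⟩
                D * (t * w - r * w) - (D * k) * w
                  ≈⟨ +-congˡ (-‿cong (trans (*-congʳ Dk≈1) (*-identityˡ w))) ⟩
                D * (t * w - r * w) - w ∎))
            where w = ∥ x ∥²

        shifted-sym : IsSymmetric (scalar-minus t A)
        shifted-sym i j = +-cong (*-congˡ (reflexive (basis-sym i j))) (-‿cong (A-sym i j))

        shifted-psd : PositiveSemidefinite (scalar-minus t A)
        shifted-psd x = ≤-respʳ-≈ (sym (scalar-minus-form t A x)) (x≤y⇒0≤y-x (form≤t x))

        eigenvalue : IsEigenvalue A t
        eigenvalue = Sum.[ eigenvector , (λ coercive → contradiction coercive not-coercive) ]′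
          (null-or-coercive (scalar-minus t A) shifted-sym shifted-psd)
          where
          eigenvector : NullVector (scalar-minus t A) → IsEigenvalue A t
          eigenvector (x , x≉0 , null) = x , x≉0 , λ i → begin-equality
            (A *ᵥ x) i                                ≈⟨ solve 2 (λ p q → q := p :- (p :- q))
                                                           refl (t * x i) ((A *ᵥ x) i) ⟩
            t * x i - (t * x i - (A *ᵥ x) i)          ≈⟨ +-congˡ (-‿cong (trans (sym
                                                           (scalar-minus-*ᵥ t A x i)) (null i))) ⟩
            t * x i - 0#                              ≈⟨ solve 1 (λ p → p :- con (+ 0) := p)
                                                           refl (t * x i) ⟩
            t * x i                                   ∎

    largest-quotient : ∃ λ t → IsEigenvalue A t × (∀ x → form A x ≤ t * ∥ x ∥²)
    largest-quotient =
      let t , lub = complete BelowQuotient (_ , quotient 0<∥v∥²) (C , bounded)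
      in t , Supremum.eigenvalue lub , Supremum.form≤t lub

  -- Polarisation: with u = A x, the forms at u + t x and u − t x differ by 4 t |u|².
  form-bound⇒norm-bound : {A : Matrix n} → IsSymmetric A → ∀ {t} → 0# < t →
    (∀ x → form A x ≤ t * ∥ x ∥²) → (∀ x → - form A x ≤ t * ∥ x ∥²) →
    ∀ x → ∥ A *ᵥ x ∥² ≤ t * t * ∥ x ∥²
  form-bound⇒norm-bound {A = A} A-sym {t} 0<t A≤t -A≤t x =
    *-cancelˡ-≤ (*-pos (fromℕ-pos {2} (ℕ.s≤s ℕ.z≤n)) 0<t)
      (≤-from (+-nonNeg (x≤y⇒0≤y-x (A≤t p)) (x≤y⇒0≤y-x (-A≤t q)))
        (sym (trans (+-cong (+-cong (*-congˡ (norm t)) (-‿cong (value t)))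
                            (+-cong (*-congˡ (norm (- t))) (-‿cong (-‿cong (value (- t))))))
          (solve 6 (λ t f v w b a →
            (t :* (con (+ 1) :* con (+ 1) :* v :+ con (+ 2) :* (con (+ 1) :* t) :* b :+ t :* t :* w)
              :- (con (+ 1) :* con (+ 1) :* a :+ con (+ 2) :* (con (+ 1) :* t) :* v :+ t :* t :* f))
            :+ (t :* (con (+ 1) :* con (+ 1) :* v :+ con (+ 2) :* (con (+ 1) :* (:- t)) :* b
                        :+ (:- t) :* (:- t) :* w)
              :- (:- (con (+ 1) :* con (+ 1) :* a :+ con (+ 2) :* (con (+ 1) :* (:- t)) :* v
                        :+ (:- t) :* (:- t) :* f)))
            := con (+ 2) :* t :* (t :* t :* w) :- con (+ 2) :* t :* v) refl
            t (form A x) ∥ u ∥² ∥ x ∥² ⟨ u , x ⟩ (form A u)))))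
    where
    u = A *ᵥ x
    p = combine 1# u t x
    q = combine 1# u (- t) x
    value : ∀ s → form A (combine 1# u s x)
              ≈ 1# * 1# * form A u + fromℕ 2 * (1# * s) * ∥ u ∥² + s * s * form A x
    value s = form-combine A-sym 1# s u x
    norm : ∀ s → ∥ combine 1# u s x ∥²
              ≈ 1# * 1# * ∥ u ∥² + fromℕ 2 * (1# * s) * ⟨ u , x ⟩ + s * s * ∥ x ∥²
    norm s = trans (⟨⟩-linearʳ 1# s (combine 1# u s x) u x)
      (trans (+-cong (*-congˡ (⟨⟩-linearˡ 1# s u x u)) (*-congˡ (⟨⟩-linearˡ 1# s u x x)))
        (trans (+-congʳ (*-congˡ (+-congˡ (*-congˡ (⟨⟩-comm x u)))))
          (solve 4 (λ s a b d → con (+ 1) :* (con (+ 1) :* a :+ s :* b) :+ s :* (con (+ 1) :* b :+ s :* d)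
             := con (+ 1) :* con (+ 1) :* a :+ con (+ 2) :* (con (+ 1) :* s) :* b :+ s :* s :* d)
             refl s ∥ u ∥² ⟨ u , x ⟩ ∥ x ∥²)))

-- The Motzkin-Straus inequality.

module MotzkinStraus {c ℓ₁ ℓ₂} (ℝ : CompleteOrderedField c ℓ₁ ℓ₂)
                     {n : ℕ} (G : SimpleGraph n) where
  open CompleteOrderedField ℝ hiding (zero)
  open RealOps ℝ
  open SimpleGraph G
  open Irregularity ℝ G
  open IntegerSolver commutativeRing
  open OrderedField ℝ
  open QuadraticForms ℝ
  open ≤-Reasoning

  adjacency-sym : ∀ i j → adjacencyMatrix i j ≡ adjacencyMatrix j i
  adjacency-sym i j with i ~? j | j ~? i
  ... | yes _   | yes _   = ≡.refl
  ... | no  _   | no  _   = ≡.refl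
  ... | yes i~j | no  j≁i = contradiction (symm i~j) j≁i
  ... | no  i≁j | yes j~i = contradiction (symm j~i) i≁j

  adjacency-symmetric : IsSymmetric adjacencyMatrix
  adjacency-symmetric i j = reflexive (adjacency-sym i j)

  adjacency-~ : ∀ {i j} → i ~ j → adjacencyMatrix i j ≡ 1#
  adjacency-~ {i} {j} i~j = ≡.cong (if_then 1# else 0#) (dec-true (i ~? j) i~j)

  adjacency-≁ : ∀ {i j} → ¬ i ~ j → adjacencyMatrix i j ≡ 0#
  adjacency-≁ {i} {j} i≁j = ≡.cong (if_then 1# else 0#) (dec-false (i ~? j) i≁j)

  adjacency-nonNeg : ∀ i j → 0# ≤ adjacencyMatrix i j
  adjacency-nonNeg i j with i ~? j
  ... | yes _ = 0≤1
  ... | no  _ = ≤-refl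

  -- The absence of loops leaves room for the identity on the diagonal.
  adjacency+basis≤1 : ∀ i j → adjacencyMatrix i j + basis i j ≤ 1#
  adjacency+basis≤1 i j with i Fin.≟ j
  ... | yes ≡.refl = ≤-reflexive (trans
    (+-cong (reflexive (adjacency-≁ (irrefl ≡.refl))) (reflexive (basis-≡ i))) (+-identityˡ 1#))
  ... | no i≢j with i ~? j
  ...   | yes _ = ≤-reflexive (trans (+-congˡ (reflexive (basis-≢ i≢j))) (+-identityʳ 1#))
  ...   | no  _ = ≤-respˡ-≈ (sym (trans (+-congˡ (reflexive (basis-≢ i≢j))) (+-identityʳ 0#))) 0≤1

  NonNeg : (Fin n → Carrier) → Set ℓ₂
  NonNeg y = ∀ i → 0# ≤ y i

  SupportedOn : Subset n → (Fin n → Carrier) → Set ℓ₁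
  SupportedOn S y = ∀ {i} → i ∉ S → y i ≈ 0#

  -- The entrywise comparison of A + I with the all-ones matrix, multiplied by y i and y j and
  -- summed. It is an equality for `y` supported on a clique.
  form+∥∥²≤sum² : ∀ {y} → NonNeg y → form adjacencyMatrix y + ∥ y ∥² ≤ sum y * sum y
  form+∥∥²≤sum² {y} 0≤y = begin
    form adjacencyMatrix y + ∥ y ∥²
      ≈⟨ ∑-distrib-+ (λ i → y i * (adjacencyMatrix *ᵥ y) i) (λ i → y i * y i) ⟨
    sum (λ i → y i * (adjacencyMatrix *ᵥ y) i + y i * y i)
      ≤⟨ sum-mono-≤ (λ i → ≤-respˡ-≈ (distribˡ (y i) _ _) (*-monoˡ-≤ (0≤y i) (row i))) ⟩
    sum (λ i → y i * sum y)
      ≈⟨ sum-cong-≋ (λ i → *-comm (y i) (sum y)) ⟩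
    sum (λ i → sum y * y i)
      ≈⟨ *-distribˡ-sum (sum y) y ⟨
    sum y * sum y ∎
    where
    row : ∀ i → (adjacencyMatrix *ᵥ y) i + y i ≤ sum y
    row i = begin
      (adjacencyMatrix *ᵥ y) i + y i
        ≈⟨ +-congˡ (⟨basis,⟩ i y) ⟨
      (adjacencyMatrix *ᵥ y) i + ⟨ basis i , y ⟩
        ≈⟨ ∑-distrib-+ (λ j → adjacencyMatrix i j * y j) (λ j → basis i j * y j) ⟨
      sum (λ j → adjacencyMatrix i j * y j + basis i j * y j)
        ≤⟨ sum-mono-≤ (λ j → ≤-respˡ-≈ (distribʳ (y j) _ _)
             (*-monoʳ-≤ (0≤y j) (adjacency+basis≤1 i j))) ⟩
      sum (λ j → 1# * y j)
        ≈⟨ sum-cong-≋ (λ j → *-identityˡ (y j)) ⟩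
      sum y ∎

  private
    indicator : ∀ {k} → Subset k → Fin k → Carrier
    indicator (_       ∷ S) (suc i) = indicator S i
    indicator (inside  ∷ S) zero    = 1#
    indicator (outside ∷ S) zero    = 0#

    sum-indicator : ∀ {k} (S : Subset k) → sum (indicator S) ≈ fromℕ ∣ S ∣
    sum-indicator []            = refl
    sum-indicator (inside  ∷ S) = +-congˡ (sum-indicator S)
    sum-indicator (outside ∷ S) = trans (+-identityˡ _) (sum-indicator S)

    indicator-∈ : ∀ {k} {S : Subset k} {i} → i ∈ S → indicator S i ≡ 1#
    indicator-∈ {S = inside ∷ S} here        = ≡.refl
    indicator-∈ {S = _ ∷ S}      (there i∈S) = indicator-∈ i∈S

    indicator-nonNeg : ∀ {k} (S : Subset k) i → 0# ≤ indicator S i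
    indicator-nonNeg (inside  ∷ S) zero    = 0≤1
    indicator-nonNeg (outside ∷ S) zero    = ≤-refl
    indicator-nonNeg (_       ∷ S) (suc i) = indicator-nonNeg S i

  -- Cauchy-Schwarz against the indicator of `S`, whose entries are their own squares, so that its
  -- squared norm is `∣ S ∣`.
  sum²≤∣S∣∥∥² : ∀ {S y} → SupportedOn S y → sum y * sum y ≤ fromℕ ∣ S ∣ * ∥ y ∥²
  sum²≤∣S∣∥∥² {S} {y} y-supp = ≤-respʳ-≈ (*-congʳ (sum-indicator S))
    (discriminant (sum-NonNegForm pointwise))
    where
    pointwise : ∀ i → NonNegForm (indicator S i) (y i) (y i * y i)
    pointwise i s t with i ∈? S
    ... | yes i∈S = ≤-respʳ-≈ (trans
            (solve 3 (λ s t y → (s :+ t :* y) :* (s :+ t :* y)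
              := s :* s :* con (+ 1) :+ con (+ 2) :* (s :* t) :* y :+ t :* t :* (y :* y)) refl s t (y i))
            (+-congʳ (+-congʳ (*-congˡ (reflexive (≡.sym (indicator-∈ i∈S)))))))
          (square-nonNeg (s + t * y i))
    ... | no  i∉S = ≤-respʳ-≈ (trans
            (solve 3 (λ s t e → s :* s :* e :=
              s :* s :* e :+ con (+ 2) :* (s :* t) :* con (+ 0) :+ t :* t :* (con (+ 0) :* con (+ 0)))
              refl s t (indicator S i))
            (+-cong (+-congˡ (*-congˡ (sym (y-supp i∉S))))
              (*-congˡ (*-cong (sym (y-supp i∉S)) (sym (y-supp i∉S))))))
          (*-nonNeg (square-nonNeg s) (indicator-nonNeg S i))

  module _ (ω : ℕ) where
    private
      Ω : Carrier
      Ω = fromℕ ω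

    -- Made homogeneous and cleared of denominators: `y` need not be scaled to the simplex, and y =
    -- 0 is no exception.
    SimplexBound : (Fin n → Carrier) → Set ℓ₂
    SimplexBound y = Ω * form adjacencyMatrix y ≤ (Ω - 1#) * (sum y * sum y)

    -- Adding Ω times q(y) + |y|² ≤ (Σ y)² to (Σ y)² ≤ Ω |y|² cancels the norms.
    small-support : ∀ {S y} → ∣ S ∣ ℕ.≤ ω → NonNeg y → SupportedOn S y → SimplexBound y
    small-support {S} {y} ∣S∣≤ω 0≤y y-supp =
      ≤-from (+-nonNeg (*-nonNeg (fromℕ-nonNeg ω) (x≤y⇒0≤y-x (form+∥∥²≤sum² 0≤y)))
                       (x≤y⇒0≤y-x sum²≤Ω∥y∥²))
        (solve 4 (λ Ω q w p → (Ω :- con (+ 1)) :* p :- Ω :* q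
           := Ω :* (p :- (q :+ w)) :+ (Ω :* w :- p)) refl Ω (form adjacencyMatrix y) ∥ y ∥² (sum y * sum y))
      where
      sum²≤Ω∥y∥² : sum y * sum y ≤ Ω * ∥ y ∥²
      sum²≤Ω∥y∥² = ≤-trans (sum²≤∣S∣∥∥² {S} y-supp) (*-monoʳ-≤ (∥∥²-nonNeg y) (fromℕ-mono ∣S∣≤ω))

    module Transfer (y : Fin n → Carrier) {i j : Fin n} (i≢j : i ≢ j) (i≁j : ¬ i ~ j) where
      direction : Fin n → Carrier
      direction = combine 1# (basis i) (- 1#) (basis j)

      -- The step length is the whole weight of `j`, the largest that keeps the entries nonnegative,
      -- so that `j` leaves the support.
      transfer : Fin n → Carrier
      transfer = combine 1# y (y j) direction

      private
        ⟨direction,⟩ : ∀ x → ⟨ direction , x ⟩ ≈ x i - x j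
        ⟨direction,⟩ x = trans (⟨⟩-linearˡ 1# (- 1#) (basis i) (basis j) x)
          (trans (+-cong (*-congˡ (⟨basis,⟩ i x)) (*-congˡ (⟨basis,⟩ j x)))
            (solve 2 (λ a b → con (+ 1) :* a :+ :- con (+ 1) :* b := a :- b) refl (x i) (x j)))

        A*direction : ∀ k → (adjacencyMatrix *ᵥ direction) k
                              ≈ adjacencyMatrix k i - adjacencyMatrix k j
        A*direction k = trans (⟨⟩-comm (adjacencyMatrix k) direction) (⟨direction,⟩ (adjacencyMatrix k))

        form-direction : form adjacencyMatrix direction ≈ 0#
        form-direction = trans (⟨direction,⟩ (adjacencyMatrix *ᵥ direction))
          (trans (+-cong (vanish i (irrefl ≡.refl) i≁j)
                   (-‿cong (vanish j (i≁j ∘ symm) (irrefl ≡.refl))))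
            (-‿inverseʳ 0#))
          where
          vanish : ∀ k → ¬ k ~ i → ¬ k ~ j → (adjacencyMatrix *ᵥ direction) k ≈ 0#
          vanish k k≁i k≁j = trans (A*direction k)
            (trans (+-cong (reflexive (adjacency-≁ k≁i)) (-‿cong (reflexive (adjacency-≁ k≁j))))
              (-‿inverseʳ 0#))

        sum-basis : ∀ (k : Fin n) → sum (basis k) ≈ 1#
        sum-basis k = trans (sum-cong-≋ (λ l → sym (*-identityʳ (basis k l))))
          (⟨basis,⟩ k (λ _ → 1#))

      sum-transfer : sum transfer ≈ sum y
      sum-transfer = trans (sum-linear 1# (y j) y direction)
        (trans (+-congˡ (*-congˡ (trans (sum-linear 1# (- 1#) (basis i) (basis j))
                 (+-cong (*-congˡ (sum-basis i)) (*-congˡ (sum-basis j))))))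
          (solve 2 (λ p q → con (+ 1) :* p :+ q :* (con (+ 1) :* con (+ 1) :+ :- con (+ 1) :* con (+ 1))
                     := p) refl (sum y) (y j)))

      -- The quadratic term vanishes because the four entries of A at `i` and `j` are zero; the
      -- slope is the difference of the two neighbourhood sums.
      transfer-form : form adjacencyMatrix transfer ≈ form adjacencyMatrix y
        + fromℕ 2 * (y j * ((adjacencyMatrix *ᵥ y) i - (adjacencyMatrix *ᵥ y) j))
      transfer-form = trans (form-combine adjacency-symmetric 1# (y j) y direction)
        (trans (+-cong (+-congˡ (*-congˡ (trans (*ᵥ-symmetric adjacency-symmetric y direction)
                                           (⟨direction,⟩ (adjacencyMatrix *ᵥ y)))))
                 (*-congˡ form-direction))
          (solve 3 (λ f t g → con (+ 1) :* con (+ 1) :* f :+ con (+ 2) :* (con (+ 1) :* t) :* g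
                                :+ t :* t :* con (+ 0)
                     := f :+ con (+ 2) :* (t :* g)) refl
             (form adjacencyMatrix y) (y j) ((adjacencyMatrix *ᵥ y) i - (adjacencyMatrix *ᵥ y) j)))

      transfer-source : transfer j ≈ 0#
      transfer-source = trans
        (+-congˡ (*-congˡ (+-cong (*-congˡ (reflexive (basis-≢ i≢j))) (*-congˡ (reflexive (basis-≡ j))))))
        (solve 1 (λ p → con (+ 1) :* p :+ p :* (con (+ 1) :* con (+ 0) :+ :- con (+ 1) :* con (+ 1))
                    := con (+ 0)) refl (y j))

      transfer-other : ∀ {k} → k ≢ j → transfer k ≈ y k + y j * basis i k
      transfer-other {k} k≢j = trans
        (+-congˡ (*-congˡ (+-congˡ (*-congˡ (reflexive (basis-≢ (k≢j ∘ ≡.sym)))))))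
        (solve 3 (λ p q e → con (+ 1) :* p :+ q :* (con (+ 1) :* e :+ :- con (+ 1) :* con (+ 0))
                    := p :+ q :* e) refl (y k) (y j) (basis i k))

      transfer-nonNeg : NonNeg y → NonNeg transfer
      transfer-nonNeg 0≤y k with k Fin.≟ j
      ... | yes ≡.refl = ≤-reflexive (sym transfer-source)
      ... | no  k≢j    = ≤-respʳ-≈ (sym (transfer-other k≢j))
        (+-nonNeg (0≤y k) (*-nonNeg (0≤y j) (basis-nonNeg i k)))

      transfer-supported : ∀ {S} → i ∈ S → SupportedOn S y → SupportedOn (S ∖ j) transfer
      transfer-supported i∈S y-supp {k} k∉S-j with k Fin.≟ j
      ... | yes ≡.refl = transfer-source
      ... | no  k≢j    = trans (transfer-other k≢j)
        (trans (+-cong (y-supp k∉S) (*-congˡ (reflexive (basis-≢ i≢k))))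
          (trans (+-identityˡ _) (zeroʳ (y j))))
        where
        k∉S = λ k∈S → k∉S-j (x∈p∧x≢y⇒x∈p-y k∈S k≢j)
        i≢k : i ≢ k
        i≢k ≡.refl = k∉S i∈S

      -- Weight moved towards the larger neighbourhood sum does not decrease the form, and the total
      -- is unchanged.
      transfer-reflects : 0# ≤ y j → (adjacencyMatrix *ᵥ y) j ≤ (adjacencyMatrix *ᵥ y) i →
                          SimplexBound transfer → SimplexBound y
      transfer-reflects 0≤yⱼ Ayⱼ≤Ayᵢ bound = begin
        Ω * form adjacencyMatrix y
          ≤⟨ *-monoˡ-≤ (fromℕ-nonNeg ω) (≤-from
               (*-nonNeg (fromℕ-nonNeg 2) (*-nonNeg 0≤yⱼ (x≤y⇒0≤y-x Ayⱼ≤Ayᵢ)))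
               (trans (+-congʳ transfer-form)
                 (solve 2 (λ p q → p :+ q :- p := q) refl (form adjacencyMatrix y) _))) ⟩
        Ω * form adjacencyMatrix transfer
          ≤⟨ bound ⟩
        (Ω - 1#) * (sum transfer * sum transfer)
          ≈⟨ *-congˡ (*-cong sum-transfer sum-transfer) ⟩
        (Ω - 1#) * (sum y * sum y) ∎

    module _ (clique≤ω : ∀ S → IsClique S → ∣ S ∣ ℕ.≤ ω) where
      private
        NonEdgeIn : Subset n → Set
        NonEdgeIn S = ∃ λ i → ∃ λ j → i ∈ S × j ∈ S × i ≢ j × ¬ i ~ j

        nonEdgeIn? : ∀ S → Dec (NonEdgeIn S)
        nonEdgeIn? S = any? λ i → any? λ j →
          (i ∈? S) ×-dec (j ∈? S) ×-dec ¬? (i Fin.≟ j) ×-dec ¬? (i ~? j)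

        -- Induction on `k`, which bounds a set containing the support and not the support itself:
        -- the set loses `j` even when `y j` is already zero.
        bounded : ∀ k S y → ∣ S ∣ ℕ.< k → NonNeg y → SupportedOn S y → SimplexBound y
        bounded (suc k) S y (ℕ.s≤s ∣S∣≤k) 0≤y y-supp with nonEdgeIn? S
        ... | no clique = small-support (clique≤ω S S-clique) 0≤y y-supp
          where
          S-clique : IsClique S
          S-clique {i} {j} i∈S j∈S i≢j with i ~? j
          ... | yes i~j = i~j
          ... | no  i≁j = contradiction (i , j , i∈S , j∈S , i≢j , i≁j) clique
        ... | yes (i , j , i∈S , j∈S , i≢j , i≁j) =
          -- The pair is symmetric, so `total` may decide which of the two vertices is emptied.
          Sum.[ move i∈S j∈S i≢j i≁j , move j∈S i∈S (i≢j ∘ ≡.sym) (i≁j ∘ symm) ]′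
            (total ((adjacencyMatrix *ᵥ y) j) ((adjacencyMatrix *ᵥ y) i))
          where
          move : ∀ {i j} → i ∈ S → j ∈ S → i ≢ j → ¬ i ~ j →
                 (adjacencyMatrix *ᵥ y) j ≤ (adjacencyMatrix *ᵥ y) i → SimplexBound y
          move {i} {j} i∈S j∈S i≢j i≁j Ayⱼ≤Ayᵢ = transfer-reflects (0≤y j) Ayⱼ≤Ayᵢ
            (bounded k (S ∖ j) transfer (ℕ.≤-trans (x∈p⇒∣p-x∣<∣p∣ j∈S) ∣S∣≤k)
              (transfer-nonNeg 0≤y) (λ {k} → transfer-supported {S} i∈S y-supp {k}))
            where open Transfer y i≢j i≁j

      motzkin-straus : ∀ {y} → NonNeg y → SimplexBound y
      motzkin-straus {y} 0≤y = bounded (suc n) ⊤ y (ℕ.s≤s (ℕ.≤-reflexive (∣⊤∣≡n n))) 0≤y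
        (λ {i} i∉⊤ → contradiction ∈⊤ i∉⊤)

-- Sums over lists.

module ListSums {c ℓ₁ ℓ₂} (ℝ : CompleteOrderedField c ℓ₁ ℓ₂) where
  open CompleteOrderedField ℝ hiding (zero)
  open RealOps ℝ
  open IntegerSolver commutativeRing
  open OrderedField ℝ

  private
    variable
      a b p : Level
      X : Set a
      Y : Set b

  listSum : (X → Carrier) → List X → Carrier
  listSum f xs = List.foldr _+_ 0# (List.map f xs)

  listSum-cong : {f g : X → Carrier} → (∀ x → f x ≈ g x) → ∀ xs → listSum f xs ≈ listSum g xs
  listSum-cong f≈g []       = refl
  listSum-cong f≈g (x ∷ xs) = +-cong (f≈g x) (listSum-cong f≈g xs)

  listSum-nonNeg : {f : X → Carrier} → (∀ x → 0# ≤ f x) → ∀ xs → 0# ≤ listSum f xs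
  listSum-nonNeg 0≤f []       = ≤-refl
  listSum-nonNeg 0≤f (x ∷ xs) = +-nonNeg (0≤f x) (listSum-nonNeg 0≤f xs)

  listSum-pos : {f : X → Carrier} → (∀ x → 0# ≤ f x) → ∀ {xs} → 1 ℕ.≤ List.length xs →
                All (λ x → 0# < f x) xs → 0# < listSum f xs
  listSum-pos 0≤f {x ∷ xs} _ (0<fx ∷ _) = +-pos 0<fx (listSum-nonNeg 0≤f xs)

  listSum-1# : (xs : List X) → listSum (λ _ → 1#) xs ≡ fromℕ (List.length xs)
  listSum-1# []       = ≡.refl
  listSum-1# (x ∷ xs) = ≡.cong (_+_ 1#) (listSum-1# xs)

  listSum-NonNegForm : {f g h : X → Carrier} → (∀ x → NonNegForm (f x) (g x) (h x)) →
                       ∀ xs → NonNegForm (listSum f xs) (listSum g xs) (listSum h xs)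
  listSum-NonNegForm form []       = NonNegForm-0#
  listSum-NonNegForm form (x ∷ xs) = NonNegForm-+ (form x) (listSum-NonNegForm form xs)

  listSum-cauchy : (f : X → Carrier) → ∀ xs →
    listSum f xs * listSum f xs ≤ fromℕ (List.length xs) * listSum (λ x → f x * f x) xs
  listSum-cauchy f xs = ≤-respʳ-≈ (*-congʳ (reflexive (listSum-1# xs)))
    (discriminant (listSum-NonNegForm (λ x s t → ≤-respʳ-≈
      (solve 3 (λ s t y → (s :+ t :* y) :* (s :+ t :* y)
         := s :* s :* con (+ 1) :+ con (+ 2) :* (s :* t) :* y :+ t :* t :* (y :* y)) refl s t (f x))
      (square-nonNeg (s + t * f x))) xs))

  indicator : {P : Pred X p} → Decidable P → X → Carrier
  indicator P? x = if does (P? x) then 1# else 0#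

  -- Turns a filter into a 0-1 weight, so that degrees and edge sums become sums over matrix
  -- entries.
  listSum-filter : {P : Pred X p} (P? : Decidable P) (f : X → Carrier) → ∀ xs →
                   listSum f (List.filter P? xs) ≈ listSum (λ x → indicator P? x * f x) xs
  listSum-filter P? f [] = refl
  listSum-filter P? f (x ∷ xs) with does (P? x)
  ... | true  = +-cong (sym (*-identityˡ (f x))) (listSum-filter P? f xs)
  ... | false = trans (sym (+-identityˡ _)) (+-cong (sym (zeroˡ (f x))) (listSum-filter P? f xs))

  listSum-++ : (f : X → Carrier) → ∀ xs ys → listSum f (xs ++ ys) ≈ listSum f xs + listSum f ys
  listSum-++ f []       ys = sym (+-identityˡ _)
  listSum-++ f (x ∷ xs) ys = trans (+-congˡ (listSum-++ f xs ys)) (sym (+-assoc _ _ _))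

  listSum-map : (f : Y → Carrier) (g : X → Y) → ∀ xs → listSum f (List.map g xs) ≡ listSum (f ∘ g) xs
  listSum-map f g []       = ≡.refl
  listSum-map f g (x ∷ xs) = ≡.cong (_+_ (f (g x))) (listSum-map f g xs)

  listSum-cartesianProduct : (f : X × Y → Carrier) → ∀ xs ys →
    listSum f (List.cartesianProduct xs ys) ≈ listSum (λ x → listSum (λ y → f (x , y)) ys) xs
  listSum-cartesianProduct f []       ys = refl
  listSum-cartesianProduct f (x ∷ xs) ys = trans (listSum-++ f (List.map (x ,_) ys) _)
    (+-cong (reflexive (listSum-map f (x ,_) ys)) (listSum-cartesianProduct f xs ys))

  listSum-tabulate : ∀ {n} (f : X → Carrier) (g : Fin n → X) →
                     listSum f (List.tabulate g) ≡ sum (f ∘ g)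
  listSum-tabulate {n = zero}  f g = ≡.refl
  listSum-tabulate {n = suc n} f g = ≡.cong (_+_ (f (g zero))) (listSum-tabulate f (g ∘ suc))

  listSum-pairs : ∀ {n} (f : Fin n × Fin n → Carrier) →
    listSum f (List.cartesianProduct (List.allFin n) (List.allFin n))
      ≈ sum (λ i → sum (λ j → f (i , j)))
  listSum-pairs {n} f = trans (listSum-cartesianProduct f (List.allFin n) (List.allFin n))
    (trans (listSum-cong (λ i → reflexive (listSum-tabulate (λ j → f (i , j)) id)) (List.allFin n))
      (reflexive (listSum-tabulate (λ i → sum (λ j → f (i , j))) id)))

-- Degrees and sums over the edges.

module EdgeSums {c ℓ₁ ℓ₂} (ℝ : CompleteOrderedField c ℓ₁ ℓ₂)
                {n : ℕ} (G : SimpleGraph n) where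
  open CompleteOrderedField ℝ hiding (zero)
  open RealOps ℝ
  open SimpleGraph G
  open Irregularity ℝ G
  open IntegerSolver commutativeRing
  open OrderedField ℝ
  open QuadraticForms ℝ
  open ListSums ℝ
  open MotzkinStraus ℝ G
  open ≤-Reasoning

  ones : Fin n → Carrier
  ones _ = 1#

  degrees : Fin n → Carrier
  degrees i = fromℕ (degree i)

  m N : Carrier
  m = fromℕ edgeCount
  N = fromℕ n

  degrees≈A*ones : ∀ i → degrees i ≈ (adjacencyMatrix *ᵥ ones) i
  degrees≈A*ones i = begin-equality
    fromℕ (degree i)
      ≡⟨ listSum-1# (List.filter (i ~?_) (List.allFin n)) ⟨
    listSum ones (List.filter (i ~?_) (List.allFin n))
      ≈⟨ listSum-filter (i ~?_) ones (List.allFin n) ⟩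
    -- `indicator (i ~?_) j` and `adjacencyMatrix i j` unfold to the same term.
    listSum (λ j → adjacencyMatrix i j * 1#) (List.allFin n)
      ≡⟨ listSum-tabulate (λ j → adjacencyMatrix i j * 1#) id ⟩
    (adjacencyMatrix *ᵥ ones) i ∎

  private
    ordered? : Decidable {A = Fin n × Fin n} (λ (i , j) → (i Fin.< j) × (i ~ j))
    ordered? (i , j) = (i <? j) ×-dec (i ~? j)

    pairs : List (Fin n × Fin n)
    pairs = List.cartesianProduct (List.allFin n) (List.allFin n)

    -- The strict upper triangle of the adjacency matrix, since `edges` lists each edge with its
    -- smaller end first.
    upper : Matrix n
    upper i j = indicator ordered? (i , j)

    upper-< : ∀ {i j} → i Fin.< j → upper i j ≡ adjacencyMatrix i j
    upper-< {i} {j} i<j =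
      -- `does` of a `×-dec` is a conjunction, so its first factor can be replaced by `true`.
      ≡.cong (λ b → if b ∧ does (i ~? j) then 1# else 0#) (dec-true (i <? j) i<j)

    upper-≮ : ∀ {i j} → ¬ i Fin.< j → upper i j ≡ 0#
    upper-≮ {i} {j} i≮j =
      ≡.cong (λ b → if b ∧ does (i ~? j) then 1# else 0#) (dec-false (i <? j) i≮j)

    adjacency≈upper+upperᵀ : ∀ i j → adjacencyMatrix i j ≈ upper i j + upper j i
    adjacency≈upper+upperᵀ i j with <-cmp i j
    ... | tri< i<j _ j≮i = trans (sym (+-identityʳ _))
      (sym (+-cong (reflexive (upper-< i<j)) (reflexive (upper-≮ j≮i))))
    ... | tri> i≮j _ j<i = trans (adjacency-symmetric i j) (trans (sym (+-identityˡ _))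
      (sym (+-cong (reflexive (upper-≮ i≮j)) (reflexive (upper-< j<i)))))
    ... | tri≈ i≮j ≡.refl _ = trans (reflexive (adjacency-≁ (irrefl ≡.refl)))
      (trans (sym (+-identityˡ 0#))
        (sym (+-cong (reflexive (upper-≮ i≮j)) (reflexive (upper-≮ i≮j)))))

  sumOverEdges≈ : ∀ f → sumOverEdges f ≈ sum (λ i → sum (λ j → upper i j * f i j))
  sumOverEdges≈ f = trans
    (listSum-filter ordered? (uncurry f) (List.cartesianProduct (List.allFin n) (List.allFin n)))
    (listSum-pairs (λ (i , j) → upper i j * f i j))

  -- The triangle and its transpose contribute the same amount after an exchange of summations,
  -- whence the factor 2.
  form≈edges : ∀ x → form adjacencyMatrix x ≈ fromℕ 2 * sumOverEdges (λ i j → x i * x j)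
  form≈edges x = begin-equality
    sum (λ i → x i * sum (λ j → adjacencyMatrix i j * x j))
      ≈⟨ sum-cong-≋ (λ i → *-distribˡ-sum (x i) (λ j → adjacencyMatrix i j * x j)) ⟩
    sum (λ i → sum (λ j → x i * (adjacencyMatrix i j * x j)))
      ≈⟨ sum-cong-≋ (λ i → sum-cong-≋ (λ j → trans
           (*-congˡ (*-congʳ (adjacency≈upper+upperᵀ i j)))
           (solve 4 (λ x y u v → x :* ((u :+ v) :* y) := u :* (x :* y) :+ v :* (y :* x))
              refl (x i) (x j) (upper i j) (upper j i)))) ⟩
    sum (λ i → sum (λ j → U i j + U j i))
      ≈⟨ sum-cong-≋ (λ i → ∑-distrib-+ (U i) (λ j → U j i)) ⟩
    sum (λ i → sum (U i) + sum (λ j → U j i))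
      ≈⟨ ∑-distrib-+ (λ i → sum (U i)) (λ i → sum (λ j → U j i)) ⟩
    sum (λ i → sum (U i)) + sum (λ i → sum (λ j → U j i))
      ≈⟨ +-congˡ (∑-comm (λ i j → U j i)) ⟩
    sum (λ i → sum (U i)) + sum (λ i → sum (U i))
      ≈⟨ +-cong sum≈E sum≈E ⟨
    E + E
      ≈⟨ solve 1 (λ e → e :+ e := con (+ 2) :* e) refl E ⟩
    fromℕ 2 * E ∎
    where
    U : Matrix n
    U i j = upper i j * (x i * x j)
    E = sumOverEdges (λ i j → x i * x j)
    sum≈E = sumOverEdges≈ (λ i j → x i * x j)

  form-ones : form adjacencyMatrix ones ≈ fromℕ 2 * m
  form-ones = trans (form≈edges ones) (*-congˡ (trans
    (listSum-cong (λ _ → *-identityˡ 1#) edges) (reflexive (listSum-1# edges))))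

  sum-degrees : sum degrees ≈ fromℕ 2 * m
  sum-degrees = trans (sum-cong-≋ (λ i → trans (degrees≈A*ones i) (sym (*-identityˡ _)))) form-ones

  sum-ones : sum ones ≈ N
  sum-ones = sum-replicate n

  edges-cauchy : ∀ f → sumOverEdges f * sumOverEdges f ≤ m * sumOverEdges (λ i j → f i j * f i j)
  edges-cauchy f = listSum-cauchy (uncurry f) edges

  degree-pos : ∀ {i j} → i ~ j → 0# < degrees i
  degree-pos {i} {j} i~j = <-≤-trans 0<1 (begin
    1#                             ≈⟨ *-identityʳ 1# ⟨
    1# * 1#                        ≡⟨ ≡.cong (_* 1#) (adjacency-~ i~j) ⟨
    adjacencyMatrix i j * 1#       ≤⟨ term≤sum (λ k → *-nonNeg (adjacency-nonNeg i k) 0≤1) j ⟩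
    (adjacencyMatrix *ᵥ ones) i    ≈⟨ degrees≈A*ones i ⟨
    degrees i                      ∎)

  rootDegrees : Fin n → Fin n → Carrier
  rootDegrees i j = √ (degrees i * degrees j)

  private
    0≤dd : ∀ i j → 0# ≤ degrees i * degrees j
    0≤dd i j = *-nonNeg (fromℕ-nonNeg (degree i)) (fromℕ-nonNeg (degree j))

  rootDegrees² : ∀ i j → rootDegrees i j * rootDegrees i j ≈ degrees i * degrees j
  rootDegrees² i j = √*√ (0≤dd i j)

  rootDegrees-pos : ∀ {i j} → i ~ j → 0# < rootDegrees i j
  rootDegrees-pos {i} {j} i~j r≤0 =
    *-pos (degree-pos i~j) (degree-pos (symm i~j)) (≤-reflexive (begin-equality
      degrees i * degrees j                  ≈⟨ rootDegrees² i j ⟨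
      rootDegrees i j * rootDegrees i j      ≈⟨ *-congˡ (≤-antisym r≤0 (√-nonNeg (0≤dd i j))) ⟩
      rootDegrees i j * 0#                   ≈⟨ zeroʳ _ ⟩
      0#                                     ∎))

  -- Keeps ϵ away from zero: both ends of an edge have positive degree, so every term is positive.
  sumRoots-pos : 1 ℕ.≤ edgeCount → 0# < sumOverEdges rootDegrees
  sumRoots-pos 1≤m = listSum-pos {f = uncurry rootDegrees} (λ (i , j) → √-nonNeg (0≤dd i j)) {edges} 1≤m
    (All.map (λ (_ , i~j) → rootDegrees-pos i~j) (all-filter ordered? pairs))

-- The three bounds.

module Bounds {c ℓ₁ ℓ₂} (ℝ : CompleteOrderedField c ℓ₁ ℓ₂) {n : ℕ} (G : SimpleGraph n)
  (1≤m : 1 ℕ.≤ SimpleGraph.edgeCount G)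
  (ω : ℕ) (ω-clique : SimpleGraph.IsCliqueNumber G ω) where
  open CompleteOrderedField ℝ hiding (zero)
  open RealOps ℝ
  open SimpleGraph G
  open Irregularity ℝ G
  open IntegerSolver commutativeRing
  open OrderedField ℝ
  open QuadraticForms ℝ
  open MotzkinStraus ℝ G
  open EdgeSums ℝ G
  open ≤-Reasoning

  private
    A = adjacencyMatrix
    clique≤ω = proj₂ ω-clique

  Ω : Carrier
  Ω = fromℕ ω

  0<m : 0# < m
  0<m = fromℕ-pos 1≤m

  0<2m : 0# < fromℕ 2 * m
  0<2m = *-pos (fromℕ-pos {2} (ℕ.s≤s ℕ.z≤n)) 0<m

  vertex : Fin n
  vertex = first edges 1≤m
    where
    first : ∀ xs → 1 ℕ.≤ List.length xs → Fin n
    first ((i , _) ∷ _) _ = i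

  1≤n : 1 ℕ.≤ n
  1≤n = ℕ.≤-trans (ℕ.s≤s ℕ.z≤n) (Fin.toℕ<n vertex)

  0<N : 0# < N
  0<N = fromℕ-pos 1≤n

  1≤ω : 1 ℕ.≤ ω
  1≤ω = ≡.subst (ℕ._≤ ω) (∣⁅x⁆∣≡1 vertex) (clique≤ω ⁅ vertex ⁆ singleton)
    where
    singleton : IsClique ⁅ vertex ⁆
    singleton i∈ j∈ i≢j = contradiction
      (≡.trans (x∈⁅y⁆⇒x≡y vertex i∈) (≡.sym (x∈⁅y⁆⇒x≡y vertex j∈))) i≢j

  0<Ω : 0# < Ω
  0<Ω = fromℕ-pos 1≤ω

  ∥ones∥² : ∥ ones ∥² ≈ N
  ∥ones∥² = trans (sum-cong-≋ {n} (λ _ → *-identityˡ 1#)) sum-ones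

  nikiforov : ∀ x → Ω * (form A x * form A x)
                ≤ fromℕ 2 * m * (Ω - 1#) * (∥ x ∥² * ∥ x ∥²)
  nikiforov x = begin
    Ω * (form A x * form A x)
      ≈⟨ *-congˡ (*-cong (form≈edges x) (form≈edges x)) ⟩
    Ω * (fromℕ 2 * E * (fromℕ 2 * E))
      ≤⟨ *-monoˡ-≤ (<⇒≤ 0<Ω) (≤-respˡ-≈
           (solve 1 (λ e → con (+ 4) :* (e :* e) := con (+ 2) :* e :* (con (+ 2) :* e)) refl E)
           (*-monoˡ-≤ (fromℕ-nonNeg 4) (edges-cauchy _))) ⟩
    Ω * (fromℕ 4 * (m * E²))
      ≈⟨ solve 3 (λ Ω m e → Ω :* (con (+ 4) :* (m :* e))
                     := con (+ 2) :* m :* (Ω :* (con (+ 2) :* e))) refl Ω m E² ⟩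
    fromℕ 2 * m * (Ω * (fromℕ 2 * E²))
      ≈⟨ *-congˡ (*-congˡ (trans (*-congˡ (ListSums.listSum-cong ℝ
           (λ (i , j) → solve 2 (λ x y → x :* y :* (x :* y) := x :* x :* (y :* y)) refl (x i) (x j))
           edges)) (sym (form≈edges x²)))) ⟩
    fromℕ 2 * m * (Ω * form A x²)
      ≤⟨ *-monoˡ-≤ (<⇒≤ 0<2m) (motzkin-straus ω clique≤ω {x²} (λ i → square-nonNeg (x i))) ⟩
    -- The vector `x²` is nonnegative whatever the signs of `x`, and `sum x²` is `∥ x ∥²` by
    -- definition.
    fromℕ 2 * m * ((Ω - 1#) * (∥ x ∥² * ∥ x ∥²))
      ≈⟨ *-assoc _ _ _ ⟨
    fromℕ 2 * m * (Ω - 1#) * (∥ x ∥² * ∥ x ∥²) ∎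
    where
    x² : Fin n → Carrier
    x² i = x i * x i
    E = sumOverEdges (λ i j → x i * x j)
    E² = sumOverEdges (λ i j → x i * x j * (x i * x j))

  0≤Ω-1 : 0# ≤ Ω - 1#
  0≤Ω-1 = x≤y⇒0≤y-x (≤-respˡ-≈ (+-identityʳ 1#) (fromℕ-mono 1≤ω))

  -- `C` stands for √(2m (ω - 1) / ω), given by its sign and its square, so that the proofs do not
  -- carry the root expression. In this notation Nikiforov's inequality is |q(x)| ≤ C |x|².
  module NormBound {C : Carrier} (0≤C : 0# ≤ C) (Ω*C² : Ω * (C * C) ≈ fromℕ 2 * m * (Ω - 1#)) where
    private
      0≤C∥∥² : ∀ (x : Fin n → Carrier) → 0# ≤ C * ∥ x ∥²
      0≤C∥∥² x = *-nonNeg 0≤C (∥∥²-nonNeg x)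

      form²≤ : ∀ x → form A x * form A x ≤ (C * ∥ x ∥²) * (C * ∥ x ∥²)
      form²≤ x = *-cancelˡ-≤ 0<Ω (begin
        Ω * (form A x * form A x)                      ≤⟨ nikiforov x ⟩
        fromℕ 2 * m * (Ω - 1#) * (∥ x ∥² * ∥ x ∥²)     ≈⟨ *-congʳ Ω*C² ⟨
        Ω * (C * C) * (∥ x ∥² * ∥ x ∥²)                ≈⟨ solve 3 (λ a k w → a :* (k :* k) :* (w :* w)
                                                            := a :* (k :* w :* (k :* w)))
                                                            refl Ω C ∥ x ∥² ⟩
        Ω * ((C * ∥ x ∥²) * (C * ∥ x ∥²))              ∎)

    form≤C : ∀ x → form A x ≤ C * ∥ x ∥²
    form≤C x = square-cancel-≤ (0≤C∥∥² x) (form²≤ x)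

    -form≤C : ∀ x → - form A x ≤ C * ∥ x ∥²
    -form≤C x = square-cancel-≤ (0≤C∥∥² x) (≤-respˡ-≈
      (solve 1 (λ f → f :* f := (:- f) :* (:- f)) refl (form A x)) (form²≤ x))

    -- Since 2m = q(1, ..., 1) ≤ C n, the existence of an edge excludes C = 0; polarisation divides
    -- by `C`.
    0<C : 0# < C
    0<C C≤0 = 0<2m (begin
      fromℕ 2 * m       ≈⟨ form-ones ⟨
      form A ones       ≤⟨ form≤C ones ⟩
      C * ∥ ones ∥²     ≤⟨ *-monoʳ-≤ (∥∥²-nonNeg ones) C≤0 ⟩
      0# * ∥ ones ∥²    ≈⟨ zeroˡ _ ⟩
      0#                ∎)

    -- The quotient at `ones` is the average degree. It lies below the supremum `t`, and `t` can be
    -- compared with μ because it is itself an eigenvalue.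
    2m≤μN : ∀ {μ} → IsLargestEigenvalue A μ → fromℕ 2 * m ≤ μ * N
    2m≤μN {μ} (_ , largest) =
      let t , t-eigenvalue , form≤t = Rayleigh.largest-quotient A adjacency-symmetric form≤C
                                        {v = ones} (<-respʳ-≈ (sym ∥ones∥²) 0<N)
      in below t (form≤t ones) (largest t t-eigenvalue)
      where
      below : ∀ t → form A ones ≤ t * ∥ ones ∥² → t ≤ μ → fromℕ 2 * m ≤ μ * N
      below t form≤t t≤μ = begin
        fromℕ 2 * m     ≈⟨ form-ones ⟨
        form A ones     ≤⟨ form≤t ⟩
        t * ∥ ones ∥²   ≈⟨ *-congˡ ∥ones∥² ⟩
        t * N           ≤⟨ *-monoʳ-≤ (<⇒≤ 0<N) t≤μ ⟩
        μ * N           ∎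

    Ω∥degrees∥²≤ : Ω * ∥ degrees ∥² ≤ fromℕ 2 * m * (Ω - 1#) * N
    Ω∥degrees∥²≤ = begin
      Ω * ∥ degrees ∥²
        ≈⟨ *-congˡ (sum-cong-≋ (λ i → *-cong (degrees≈A*ones i) (degrees≈A*ones i))) ⟩
      Ω * ∥ A *ᵥ ones ∥²
        ≤⟨ *-monoˡ-≤ (<⇒≤ 0<Ω) (form-bound⇒norm-bound adjacency-symmetric 0<C form≤C -form≤C ones) ⟩
      Ω * (C * C * ∥ ones ∥²)
        ≈⟨ *-assoc Ω (C * C) _ ⟨
      Ω * (C * C) * ∥ ones ∥²
        ≈⟨ *-cong Ω*C² ∥ones∥² ⟩
      fromℕ 2 * m * (Ω - 1#) * N ∎

  private
    ratio : Carrier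
    ratio = fromℕ 2 * m * (Ω - 1#) / Ω

    0≤ratio : 0# ≤ ratio
    0≤ratio = ≤-/ 0<Ω (≤-respˡ-≈ (sym (zeroʳ Ω)) (*-nonNeg (<⇒≤ 0<2m) 0≤Ω-1))

  open NormBound (√-nonNeg 0≤ratio)
    (trans (*-congˡ (√*√ 0≤ratio)) (trans (*-comm Ω ratio) (*/-cancel (<⇒≉ 0<Ω))))
    using (2m≤μN; Ω∥degrees∥²≤)

  Ωμ²≤ : ∀ {μ} → IsEigenvalue A μ → Ω * (μ * μ) ≤ fromℕ 2 * m * (Ω - 1#)
  Ωμ²≤ {μ} (x , (_ , xᵢ≉0) , Ax≈μx) =
    let form≈ = form-eigenvector A Ax≈μx
        w = ∥ x ∥²
        0<w = nonzero⇒0<∥∥² {x = x} xᵢ≉0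
    in *-cancelˡ-≤ (*-pos 0<w 0<w) (begin
      w * w * (Ω * (μ * μ))                   ≈⟨ solve 3 (λ w Ω μ → w :* w :* (Ω :* (μ :* μ))
                                                   := Ω :* (μ :* w :* (μ :* w))) refl w Ω μ ⟩
      Ω * (μ * w * (μ * w))                   ≈⟨ *-congˡ (*-cong form≈ form≈) ⟨
      Ω * (form A x * form A x)               ≤⟨ nikiforov x ⟩
      fromℕ 2 * m * (Ω - 1#) * (w * w)        ≈⟨ *-comm _ _ ⟩
      w * w * (fromℕ 2 * m * (Ω - 1#))        ∎)

  -- Makes the numerator of ν positive.
  4m²≤N∥degrees∥² : fromℕ 2 * m * (fromℕ 2 * m) ≤ N * ∥ degrees ∥²
  4m²≤N∥degrees∥² = begin
    fromℕ 2 * m * (fromℕ 2 * m)                  ≈⟨ *-cong ⟨ones,degrees⟩ ⟨ones,degrees⟩ ⟨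
    ⟨ ones , degrees ⟩ * ⟨ ones , degrees ⟩      ≤⟨ cauchy-schwarz ones degrees ⟩
    ∥ ones ∥² * ∥ degrees ∥²                     ≈⟨ *-congʳ ∥ones∥² ⟩
    N * ∥ degrees ∥²                             ∎
    where
    ⟨ones,degrees⟩ : ⟨ ones , degrees ⟩ ≈ fromℕ 2 * m
    ⟨ones,degrees⟩ = trans (sum-cong-≋ (λ i → *-identityˡ (degrees i))) sum-degrees

  R : Carrier
  R = sumOverEdges rootDegrees

  ΩR²≤ : Ω * (R * R) ≤ (Ω - 1#) * (fromℕ 2 * (m * (m * m)))
  -- Doubling turns the edge sum of d_i d_j into `form A degrees`, to which Motzkin-Straus applies.
  ΩR²≤ = *-cancelˡ-≤ (fromℕ-pos {2} (ℕ.s≤s ℕ.z≤n)) (begin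
    fromℕ 2 * (Ω * (R * R))
      ≤⟨ *-monoˡ-≤ (fromℕ-nonNeg 2) (*-monoˡ-≤ (<⇒≤ 0<Ω) (edges-cauchy rootDegrees)) ⟩
    fromℕ 2 * (Ω * (m * sumOverEdges (λ i j → rootDegrees i j * rootDegrees i j)))
      ≈⟨ *-congˡ (*-congˡ (*-congˡ (ListSums.listSum-cong ℝ (λ (i , j) → rootDegrees² i j) edges))) ⟩
    fromℕ 2 * (Ω * (m * E))
      ≈⟨ solve 3 (λ Ω m e → con (+ 2) :* (Ω :* (m :* e)) := m :* (Ω :* (con (+ 2) :* e))) refl Ω m E ⟩
    m * (Ω * (fromℕ 2 * E))
      ≈⟨ *-congˡ (*-congˡ (form≈edges degrees)) ⟨
    m * (Ω * form A degrees)
      ≤⟨ *-monoˡ-≤ (<⇒≤ 0<m) (motzkin-straus ω clique≤ω (λ i → fromℕ-nonNeg (degree i))) ⟩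
    m * ((Ω - 1#) * (sum degrees * sum degrees))
      ≈⟨ *-congˡ (*-congˡ (*-cong sum-degrees sum-degrees)) ⟩
    m * ((Ω - 1#) * (fromℕ 2 * m * (fromℕ 2 * m)))
      ≈⟨ solve 2 (λ Ω m → m :* (Ω :* (con (+ 2) :* m :* (con (+ 2) :* m)))
           := con (+ 2) :* (Ω :* (con (+ 2) :* (m :* (m :* m))))) refl (Ω - 1#) m ⟩
    fromℕ 2 * ((Ω - 1#) * (fromℕ 2 * (m * (m * m)))) ∎)
    where E = sumOverEdges (λ i j → degrees i * degrees j)

  -- Z = V / W is β², ν or ϵ².
  bound-by-ratio : ∀ {Z V W} → 0# < W → 0# < V → Z * W ≈ V →
    fromℕ 2 * m * (Ω * V) ≤ (Ω - 1#) * (N * N) * W →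
    fromℕ 2 * m ≤ ((Ω - 1#) * N ^ 2) / (Ω * Z)
  bound-by-ratio {Z} {V} {W} 0<W 0<V ZW≈V bound = ≤-/ (*-pos 0<Ω 0<Z) (*-cancelˡ-≤ 0<W (begin
    W * (Ω * Z * (fromℕ 2 * m))    ≈⟨ solve 4 (λ W Ω Z k → W :* (Ω :* Z :* k) := k :* (Ω :* (Z :* W)))
                                        refl W Ω Z (fromℕ 2 * m) ⟩
    fromℕ 2 * m * (Ω * (Z * W))    ≈⟨ *-congˡ (*-congˡ ZW≈V) ⟩
    fromℕ 2 * m * (Ω * V)          ≤⟨ bound ⟩
    (Ω - 1#) * (N * N) * W         ≈⟨ *-comm _ W ⟩
    W * ((Ω - 1#) * (N * N))       ≈⟨ *-congˡ (*-congˡ (*-congˡ (*-identityʳ N))) ⟨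
    W * ((Ω - 1#) * N ^ 2)         ∎))
    where
    0<Z : 0# < Z
    0<Z Z≤0 = 0<V (begin
      V         ≈⟨ ZW≈V ⟨
      Z * W     ≤⟨ *-monoʳ-≤ (<⇒≤ 0<W) Z≤0 ⟩
      0# * W    ≈⟨ zeroˡ W ⟩
      0#        ∎)

  private
    ^2 : ∀ x → x ^ 2 ≈ x * x
    ^2 x = *-congˡ (*-identityʳ x)

    square-ratio : ∀ {x y} → 0# < y → (x / y) ^ 2 * (y * y) ≈ x * x
    square-ratio {x} {y} 0<y = trans (*-congʳ (^2 (x / y)))
      (trans (solve 2 (λ q y → q :* q :* (y :* y) := q :* y :* (q :* y)) refl (x / y) y)
        (*-cong (*/-cancel (<⇒≉ 0<y)) (*/-cancel (<⇒≉ 0<y))))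

  β-bound : ∀ {μ} → IsLargestEigenvalue A μ → fromℕ 2 * m ≤ ((Ω - 1#) * N ^ 2) / (Ω * β μ ^ 2)
  β-bound {μ} μ-largest = bound-by-ratio (*-pos 0<2m 0<2m) (*-pos 0<μN 0<μN) (square-ratio 0<2m) (begin
    fromℕ 2 * m * (Ω * (μ * N * (μ * N)))
      ≈⟨ solve 4 (λ M Ω μ N → M :* (Ω :* (μ :* N :* (μ :* N))) := M :* (N :* N) :* (Ω :* (μ :* μ)))
           refl (fromℕ 2 * m) Ω μ N ⟩
    fromℕ 2 * m * (N * N) * (Ω * (μ * μ))
      ≤⟨ *-monoˡ-≤ (*-nonNeg (<⇒≤ 0<2m) (square-nonNeg N)) (Ωμ²≤ (proj₁ μ-largest)) ⟩
    fromℕ 2 * m * (N * N) * (fromℕ 2 * m * (Ω - 1#))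
      ≈⟨ solve 3 (λ M N O → M :* (N :* N) :* (M :* O) := O :* (N :* N) :* (M :* M))
           refl (fromℕ 2 * m) N (Ω - 1#) ⟩
    (Ω - 1#) * (N * N) * (fromℕ 2 * m * (fromℕ 2 * m)) ∎)
    where
    0<μN : 0# < μ * N
    0<μN = <-≤-trans 0<2m (2m≤μN μ-largest)

  ν-bound : fromℕ 2 * m ≤ ((Ω - 1#) * N ^ 2) / (Ω * ν)
  ν-bound = bound-by-ratio 0<W (<-≤-trans (*-pos 0<2m 0<2m) 4m²≤N∥degrees∥²)
    (trans (*/-cancel (<⇒≉ 0<W)) (*-congˡ (sum-cong-≋ (λ i → ^2 (degrees i))))) (begin
    fromℕ 2 * m * (Ω * (N * ∥ degrees ∥²))
      ≈⟨ solve 4 (λ M Ω N d → M :* (Ω :* (N :* d)) := M :* N :* (Ω :* d)) refl (fromℕ 2 * m) Ω N _ ⟩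
    fromℕ 2 * m * N * (Ω * ∥ degrees ∥²)
      ≤⟨ *-monoˡ-≤ (*-nonNeg (<⇒≤ 0<2m) (<⇒≤ 0<N)) Ω∥degrees∥²≤ ⟩
    fromℕ 2 * m * N * (fromℕ 2 * m * (Ω - 1#) * N)
      ≈⟨ solve 3 (λ m N O → con (+ 2) :* m :* N :* (con (+ 2) :* m :* O :* N)
           := O :* (N :* N) :* (con (+ 4) :* (m :* m))) refl m N (Ω - 1#) ⟩
    (Ω - 1#) * (N * N) * (fromℕ 4 * (m * m))
      ≈⟨ *-congˡ (*-congˡ (^2 m)) ⟨
    (Ω - 1#) * (N * N) * (fromℕ 4 * m ^ 2) ∎)
    where
    0<W : 0# < fromℕ 4 * m ^ 2
    0<W = *-pos (fromℕ-pos {4} (ℕ.s≤s ℕ.z≤n)) (<-respʳ-≈ (sym (^2 m)) (*-pos 0<m 0<m))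

  ϵ-bound : fromℕ 2 * m ≤ ((Ω - 1#) * N ^ 2) / (Ω * ϵ ^ 2)
  ϵ-bound = bound-by-ratio (*-pos 0<W 0<W) (*-pos 0<NR 0<NR) (square-ratio 0<W) (begin
    fromℕ 2 * m * (Ω * (N * R * (N * R)))
      ≈⟨ solve 4 (λ M Ω N R → M :* (Ω :* (N :* R :* (N :* R))) := M :* (N :* N) :* (Ω :* (R :* R)))
           refl (fromℕ 2 * m) Ω N R ⟩
    fromℕ 2 * m * (N * N) * (Ω * (R * R))
      ≤⟨ *-monoˡ-≤ (*-nonNeg (<⇒≤ 0<2m) (square-nonNeg N)) ΩR²≤ ⟩
    fromℕ 2 * m * (N * N) * ((Ω - 1#) * (fromℕ 2 * (m * (m * m))))
      ≈⟨ solve 3 (λ m N O → con (+ 2) :* m :* (N :* N) :* (O :* (con (+ 2) :* (m :* (m :* m))))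
           := O :* (N :* N) :* (con (+ 2) :* (m :* m) :* (con (+ 2) :* (m :* m)))) refl m N (Ω - 1#) ⟩
    (Ω - 1#) * (N * N) * (fromℕ 2 * (m * m) * (fromℕ 2 * (m * m)))
      ≈⟨ *-congˡ (*-cong (*-congˡ (^2 m)) (*-congˡ (^2 m))) ⟨
    (Ω - 1#) * (N * N) * (fromℕ 2 * m ^ 2 * (fromℕ 2 * m ^ 2)) ∎)
    where
    0<W : 0# < fromℕ 2 * m ^ 2
    0<W = *-pos (fromℕ-pos {2} (ℕ.s≤s ℕ.z≤n)) (<-respʳ-≈ (sym (^2 m)) (*-pos 0<m 0<m))
    0<NR : 0# < N * R
    0<NR = *-pos 0<N (sumRoots-pos 1≤m)

theorem3 :
  ∀ {c ℓ₁ ℓ₂} (ℝ : CompleteOrderedField c ℓ₁ ℓ₂)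
  {n : ℕ} (G : SimpleGraph n) →
  let open CompleteOrderedField ℝ
      open RealOps ℝ
      open SimpleGraph G
      open Irregularity ℝ G
  in
  1 ℕ.≤ edgeCount →
  (ω : ℕ) → IsCliqueNumber ω →
  (μ : Carrier) → IsLargestEigenvalue adjacencyMatrix μ →
  let m = fromℕ edgeCount
      N = fromℕ n
      Ω = fromℕ ω
  in
    (fromℕ 2 * m ≤ ((Ω - 1#) * N ^ 2) / (Ω * β μ ^ 2))
  × (fromℕ 2 * m ≤ ((Ω - 1#) * N ^ 2) / (Ω * ν))
  × (fromℕ 2 * m ≤ ((Ω - 1#) * N ^ 2) / (Ω * ϵ ^ 2))
theorem3 ℝ G 1≤m ω ω-clique μ μ-largest = β-bound μ-largest , ν-bound , ϵ-bound
  where open Bounds ℝ G 1≤m ω ω-clique
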